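{- Let $C\subseteq\mathbb{F}_2^n$ be a binary linear $[n,k,d]$ code with $\mathbf{1}_n\in C$, whose dual $C^\perp$ has minimum distance $d^\perp$, and let $t$ be a positive integer such that $$d^\perp-t=\#\{u \mid C_u\neq\emptyset,\ 0<u\le n-t\}.$$ Let $w\ge 0$ be an integer. (1) Suppose $(d^\perp,t)=(4,2)$. If $$\sum_{i=0}^{w}(-1)^{w-i}\binom{d-3}{w-i}\binom{n-2d}{2i+1}=0,$$ then $D^\perp_{2w+4}$ is a $3$-design. (2) Suppose $(d^\perp,t)=(4,1)$ or $(6,3)$. If $$\left(\sum_{i=0}^{w}(-1)^{w-i}\binom{d-(t+1)}{w-i}\binom{n-2d}{2i}\right)+(-1)^{w+1}\binom{n/2-(t+1)}{w}=0,$$ then $D^\perp_{2w+t+1}$ is a $(t+1)$-design.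
   Context: $\mathbf{1}_n$ is the all-ones vector; $C^\perp$ is the dual code with respect to the standard inner product, with minimum nonzero weight $d^\perp$; $C_u=\{c\in C:\mathrm{wt}(c)=u\}$ (Hamming weight). A $t$-design on point set $X$ is a collection of blocks ($k$-subsets of $X$) such that every $t$-subset of $X$ lies in the same number $\lambda$ of blocks. $D^\perp_w$ denotes the support design of $C^\perp$ for weight $w$: point set $\{1,\dots,n\}$, blocks the supports $\{i: c_i\ne 0\}$ of the codewords $c\in C^\perp$ of weight $w$. -}

module Defs where

open import Level using (0ℓ)
open import Data.Nat.Base as ℕ using (ℕ; zero; suc)
open import Data.Integer.Base using (+_)
open import Data.Rational.Base as ℚ using (ℚ; 1ℚ; _/_)
open import Data.Parity.Base as ℙ using (Parity; 0ℙ; 1ℙ)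
open import Data.Parity.Properties as ℙ using (_≟_)
open import Data.Fin.Base using (Fin)
open import Data.Fin.Subset using (Subset; ∣_∣; _⊆_)
open import Data.Vec.Base using (Vec; map; zipWith; replicate; lookup; tabulate)
open import Data.List.Base using (List; length)
open import Data.List.Membership.Propositional using (_∈_)
open import Data.List.Relation.Unary.Unique.Propositional using (Unique)
open import Data.Product.Base using (∃; ∃-syntax; _×_)
open import Function.Bundles using (_⇔_)
open import Relation.Nullary.Decidable using (does; ¬?)
open import Relation.Unary using (Pred)
open import Relation.Binary.PropositionalEquality using (_≡_; _≢_)
open import Algebra.Bundles using (module CommutativeRing)
open import Algebra.Properties.Monoid.Sum (CommutativeRing.+-monoid ℙ.+-*-commutativeRing) using (sum-syntax)

HasCardinality : {A : Set} → Pred A 0ℓ → ℕ → Set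
HasCardinality {A} P m =
  ∃[ xs ] Unique xs × ((x : A) → x ∈ xs ⇔ P x) × length xs ≡ m

-- Parity, with its ring structure from Data.Parity.Properties, is the
-- field with two elements.
𝔽₂ : Set
𝔽₂ = Parity

Word : ℕ → Set
Word n = Vec 𝔽₂ n

𝟎 𝟏 : (n : ℕ) → Word n
𝟎 n = replicate n 0ℙ
𝟏 n = replicate n 1ℙ

infixl 6 _⊕_
_⊕_ : ∀ {n} → Word n → Word n → Word n
_⊕_ = zipWith ℙ._+_

⟨_,_⟩ : ∀ {n} → Word n → Word n → 𝔽₂
⟨_,_⟩ {n} x y = ∑[ i < n ] (lookup x i ℙ.* lookup y i)

linearCombination : ∀ {k n} → Word k → (Fin k → Word n) → Word n
linearCombination {k} a b = tabulate λ j → ∑[ i < k ] (lookup a i ℙ.* lookup (b i) j)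

support : ∀ {n} → Word n → Subset n
support = map (λ x → does (¬? (x ≟ 0ℙ)))

wt : ∀ {n} → Word n → ℕ
wt c = ∣ support c ∣

-- Closure under scalar multiplication is automatic over 𝔽₂.
record IsSubspace {n} (C : Pred (Word n) 0ℓ) : Set where
  field
    𝟎-closed : C (𝟎 n)
    ⊕-closed : ∀ {x y} → C x → C y → C (x ⊕ y)

record IsBasis {n k} (C : Pred (Word n) 0ℓ) (b : Fin k → Word n) : Set where
  field
    member      : ∀ i → C (b i)
    spanning    : ∀ {c} → C c → ∃[ a ] linearCombination a b ≡ c
    independent : ∀ a → linearCombination a b ≡ 𝟎 n → a ≡ 𝟎 k

-- For a linear code, the minimum distance is the minimum nonzero weight.
record IsMinimumDistance {n} (C : Pred (Word n) 0ℓ) (d : ℕ) : Set where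
  field
    attained : ∃[ c ] C c × c ≢ 𝟎 n × wt c ≡ d
    minimal  : ∀ {c} → C c → c ≢ 𝟎 n → d ℕ.≤ wt c

record IsLinearCode (n k d : ℕ) (C : Pred (Word n) 0ℓ) : Set where
  field
    isSubspace        : IsSubspace C
    dimension         : ∃[ b ] IsBasis {n} {k} C b
    isMinimumDistance : IsMinimumDistance C d

infix 9 _⊥
_⊥ : ∀ {n} → Pred (Word n) 0ℓ → Pred (Word n) 0ℓ
(C ⊥) x = ∀ c → C c → ⟨ c , x ⟩ ≡ 0ℙ

infix 8 _at-weight_
_at-weight_ : ∀ {n} → Pred (Word n) 0ℓ → ℕ → Pred (Word n) 0ℓ
(C at-weight u) c = C c × wt c ≡ u

-- A family of blocks is a set (not a multiset) of subsets; distinct binary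
-- words have distinct supports, so nothing is lost for support designs.
-- The empty family is a t-design, with λ = 0.
IsDesign : ∀ {n} → ℕ → Pred (Subset n) 0ℓ → Set
IsDesign {n} t 𝓑 =
  ∃[ k ] (∀ B → 𝓑 B → ∣ B ∣ ≡ k) ×
  ∃[ l ] (∀ (T : Subset n) → ∣ T ∣ ≡ t → HasCardinality (λ B → 𝓑 B × T ⊆ B) l)

supportDesign : ∀ {n} → Pred (Word n) 0ℓ → ℕ → Pred (Subset n) 0ℓ
supportDesign C w B = ∃[ c ] (C at-weight w) c × support c ≡ B

infix 9 ↑_
↑_ : ℕ → ℚ
↑ m = + m / 1

-- x (x - 1) ⋯ (x - k + 1) / k!, so that the upper entry may be negative
-- or a half-integer.
binom : ℚ → ℕ → ℚ
binom x zero    = 1ℚ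
binom x (suc k) = binom x k ℚ.* (x ℚ.- ↑ k) ℚ.* (+ 1 / suc k)

-1^_ : ℕ → ℚ
-1^ zero  = 1ℚ
-1^ suc k = ℚ.- (-1^ k)

{-# OPTIONS --safe #-}
-- Let F S φ be the sum of χ_S(c) φ(wt c) over the codewords c, where χ_S(c) = (-1)^|S ∩ supp c|.
-- Since the dual distance is d⊥, F S φ depends only on |S| when φ is a polynomial of degree less than
-- d⊥ - |S|: multiplying φ by n - 2 wt amounts to summing F over the neighbours of S in the Hamming
-- graph.  There being d⊥ - t weights, each F S [wt = u] then depends only on |S| for |S| ≤ t, while for
-- |S| = t + 1 one degree of freedom α is left, along (1, -1) on the weights (d, n - d) or along
-- (1, -2, 1) on (d, n/2, n - d).
--
-- By MacWilliams' identity the weight enumerator of the coset S + C⊥ is F S applied to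
-- (1 - z)^u (1 + z)^(n - u), and inclusion-exclusion over the subsets of T recovers from the cosets
-- the words of C⊥ covering T, up to the factor (1 - z²)^|T|.  Hence for |T| = t + 1 the enumerator of
-- the blocks through T is independent of T up to α times
--   (1 - z²)^(d - t - 1) ((1 + z)^(n - 2d) - (1 - z)^(n - 2d)),  respectively
--   (1 - z²)^(d - t - 1) ((1 + z)^(n - 2d) + (1 - z)^(n - 2d)) - 2 (1 - z²)^(n/2 - t - 1),
-- and the hypothesis says that the relevant coefficient of this series is zero.
module Submission where

open import Level using (0ℓ)
open import Data.Bool.Base using (true; false)
open import Data.Empty using () renaming (⊥ to ⊥′)
open import Data.Fin.Base using (Fin; zero; suc; toℕ)
open import Data.Fin.Subset using (Subset; ∣_∣; _⊆_)
open import Data.Fin.Subset.Properties using (_⊆?_; out⊆; in⊆in; drop-∷-⊆; p⊆q⇒∣p∣≤∣q∣)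
import Data.Integer.Base as ℤ
import Data.Integer.Properties as ℤ
import Data.Integer.Tactic.RingSolver as ℤ-Solver
open import Data.List.Base as List using (List; []; _∷_; length)
open import Data.List.Membership.Propositional using (_∈_; _∉_)
open import Data.List.Membership.Propositional.Properties
  using (∈-++⁺ˡ; ∈-++⁺ʳ; ∈-++⁻; ∈-map⁺; ∈-map⁻; ∈-applyUpTo⁺; ∈-applyUpTo⁻)
open import Data.List.Properties using (length-++; length-map; length-applyUpTo)
open import Data.List.Relation.Unary.All as All using ([]; _∷_)
open import Data.List.Relation.Unary.AllPairs using ([]; _∷_)
open import Data.List.Relation.Unary.Any using (here; there)
open import Data.List.Relation.Unary.Unique.Propositional using (Unique)
open import Data.List.Relation.Unary.Unique.Propositional.Properties using (map⁺; ++⁺)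
open import Data.Nat.Base as ℕ using (ℕ; zero; suc; _∸_)
open import Data.Nat.GeneralisedArithmetic using (fold)
import Data.Nat.Properties as ℕ
import Data.Nat.Tactic.RingSolver as ℕ-Solver
open import Data.Parity.Base as ℙ using (0ℙ; 1ℙ)
import Data.Parity.Properties as ℙ
open import Data.Product.Base using (∃; ∃-syntax; _×_; _,_; proj₁; proj₂)
open import Data.Rational.Base using (ℚ; 0ℚ; 1ℚ; _+_; _*_; _-_; -_; _/_; ≢-nonZero; 1/_)
open import Data.Rational.Properties using (+-0-monoid)
import Data.Rational.Properties as ℚ
open import Data.Rational.Unnormalised.Base as ℚᵘ using (mkℚᵘ; *≡*)
import Data.Rational.Unnormalised.Properties as ℚᵘ
open import Data.Sum.Base using (_⊎_; inj₁; inj₂; [_,_]′)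
open import Data.Vec.Base using ([]; _∷_; here; lookup; tabulate)
open import Data.Vec.Properties using (≡-dec; lookup∘tabulate; tabulate-cong; ∷-injectiveʳ)
open import Function.Base using (_∘_; id)
open import Function.Bundles using (mk⇔; module Equivalence)
open import Relation.Binary.PropositionalEquality
open import Relation.Nullary using (Dec; yes; no; ¬_; contradiction)
open import Relation.Nullary.Decidable using (dec⇒maybe; map′; _×-dec_)
open import Relation.Unary using (Pred)
open import Tactic.RingSolver using (solve-∀)
open import Tactic.RingSolver.Core.AlmostCommutativeRing using (AlmostCommutativeRing; fromCommutativeRing)
open import Data.List.Membership.DecPropositional ℕ._≟_ using (_∈?_)
import Algebra.Properties.Monoid.Sum +-0-monoid as ℚΣ
open import Algebra.Properties.Monoid.Sum +-0-monoid using (sum⁺-syntax)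
open import Algebra.Properties.Semiring.Sum ℙ.+-*-semiring using (sum; sum-cong-≗; ∑-comm; *-distribˡ-sum; *-distribʳ-sum)
open import Defs
open ≡-Reasoning

-- The hypothesis counts only the weights up to `n - t`, whereas the polynomial argument has to know
-- every weight at which two characters can differ. The words `𝟎` and `𝟏` are harmless, since their
-- characters see only |S|, and because `𝟏` lies in C all other weights are between `d` and `n - d`.
-- So the count is complete as soon as `t ≤ d`.
--
-- The directions (1, -1) and (1, -2, 1) come from the symmetry of the weights under u ↦ n - u. For
-- |S| = t + 1 the test polynomials still available have degree 0 when there are two weights, and
-- degree at most 1 when there are three; in the latter case the middle weight is its own
-- complement, so it is n/2, and the linear polynomial with this root forces equal entries at `d`
-- and `n - d`.
--
-- Even with `t ≤ d` the exponent `d - t - 1` can be -1. Hence (1 - z²)^(t + 1) is cancelled by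
-- injectivity of multiplication, and the remaining power is a binomial series with rational
-- exponent.

ℚ-ring : AlmostCommutativeRing 0ℓ 0ℓ
ℚ-ring = fromCommutativeRing ℚ.+-*-commutativeRing λ x → dec⇒maybe (0ℚ ℚ.≟ x)

-- Rational arithmetic and indicators

x*y≡0⇒y≡0 : ∀ {x y} → x ≢ 0ℚ → x * y ≡ 0ℚ → y ≡ 0ℚ
x*y≡0⇒y≡0 {x} {y} x≢0 xy≡0 = begin
  y                ≡⟨ ℚ.*-identityˡ y ⟨
  1ℚ * y           ≡⟨ cong (_* y) (ℚ.*-inverseˡ x) ⟨
  (1/ x) * x * y   ≡⟨ ℚ.*-assoc (1/ x) x y ⟩
  (1/ x) * (x * y) ≡⟨ cong ((1/ x) *_) xy≡0 ⟩
  (1/ x) * 0ℚ      ≡⟨ ℚ.*-zeroʳ (1/ x) ⟩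
  0ℚ ∎
  where instance _ = ≢-nonZero x≢0

*-≢0 : ∀ {x y} → x ≢ 0ℚ → y ≢ 0ℚ → x * y ≢ 0ℚ
*-≢0 x≢0 y≢0 xy≡0 = y≢0 (x*y≡0⇒y≡0 x≢0 xy≡0)

x-y≡0⇒x≡y : ∀ {x y} → x - y ≡ 0ℚ → x ≡ y
x-y≡0⇒x≡y {x} {y} e = begin
  x         ≡⟨ lem x y ⟩
  x - y + y ≡⟨ cong (_+ y) e ⟩
  0ℚ + y    ≡⟨ ℚ.+-identityˡ y ⟩
  y ∎
  where
  lem : ∀ x y → x ≡ x - y + y
  lem = solve-∀ ℚ-ring

x≡y⇒x-y≡0 : ∀ {x y} → x ≡ y → x - y ≡ 0ℚ
x≡y⇒x-y≡0 {x} refl = ℚ.+-inverseʳ x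

↑-homo-+ : ∀ m n → ↑ (m ℕ.+ n) ≡ ↑ m + ↑ n
↑-homo-+ m n = ℚ.toℚᵘ-injective (ℚᵘ.≃-trans (ℚ.toℚᵘ-fromℚᵘ (mkℚᵘ (ℤ.+ (m ℕ.+ n)) 0)) (ℚᵘ.≃-trans
  (*≡* (cong (ℤ._* ℤ.+ 1) (sym (cong₂ ℤ._+_ (ℤ.*-identityʳ (ℤ.+ m)) (ℤ.*-identityʳ (ℤ.+ n))))))
  (ℚᵘ.≃-sym (ℚᵘ.≃-trans (ℚ.toℚᵘ-homo-+ (↑ m) (↑ n))
    (ℚᵘ.+-cong (ℚ.toℚᵘ-fromℚᵘ (mkℚᵘ (ℤ.+ m) 0)) (ℚ.toℚᵘ-fromℚᵘ (mkℚᵘ (ℤ.+ n) 0)))))))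

↑-suc : ∀ n → ↑ (suc n) ≡ 1ℚ + ↑ n
↑-suc = ↑-homo-+ 1

↑-injective : ∀ {m n} → ↑ m ≡ ↑ n → m ≡ n
↑-injective {m} {n} e with ℚ.fromℚᵘ-injective {mkℚᵘ (ℤ.+ m) 0} {mkℚᵘ (ℤ.+ n) 0} e
... | *≡* e′ = ℤ.+-injective (trans (sym (ℤ.*-identityʳ (ℤ.+ m))) (trans e′ (ℤ.*-identityʳ (ℤ.+ n))))

⟦_⟧ : {A : Set} → Dec A → ℚ
⟦ yes _ ⟧ = 1ℚ
⟦ no _ ⟧  = 0ℚ

⟦⟧-yes : {A : Set} (A? : Dec A) → A → ⟦ A? ⟧ ≡ 1ℚ
⟦⟧-yes (yes _) _ = refl
⟦⟧-yes (no ¬a) a = contradiction a ¬a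

⟦⟧-no : {A : Set} (A? : Dec A) → ¬ A → ⟦ A? ⟧ ≡ 0ℚ
⟦⟧-no (yes a) ¬a = contradiction a ¬a
⟦⟧-no (no _) _   = refl

⟦⟧-cong : {A B : Set} (A? : Dec A) (B? : Dec B) → (A → B) → (B → A) → ⟦ A? ⟧ ≡ ⟦ B? ⟧
⟦⟧-cong (yes a) B? f g = sym (⟦⟧-yes B? (f a))
⟦⟧-cong (no ¬a) B? f g = sym (⟦⟧-no B? (¬a ∘ g))

-- Sums over all words

∑ʷ : ∀ {k} → (Word k → ℚ) → ℚ
∑ʷ {zero}  f = f []
∑ʷ {suc k} f = ∑ʷ (f ∘ (0ℙ ∷_)) + ∑ʷ (f ∘ (1ℙ ∷_))

∑ʷ-cong : ∀ {k} {f g : Word k → ℚ} → f ≗ g → ∑ʷ f ≡ ∑ʷ g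
∑ʷ-cong {zero}  e = e []
∑ʷ-cong {suc k} e = cong₂ _+_ (∑ʷ-cong (e ∘ (0ℙ ∷_))) (∑ʷ-cong (e ∘ (1ℙ ∷_)))

∑ʷ-+ : ∀ {k} (f g : Word k → ℚ) → ∑ʷ (λ x → f x + g x) ≡ ∑ʷ f + ∑ʷ g
∑ʷ-+ {zero}  f g = refl
∑ʷ-+ {suc k} f g = trans (cong₂ _+_ (∑ʷ-+ (f ∘ (0ℙ ∷_)) (g ∘ (0ℙ ∷_))) (∑ʷ-+ (f ∘ (1ℙ ∷_)) (g ∘ (1ℙ ∷_)))) (lem (∑ʷ (f ∘ (0ℙ ∷_))) (∑ʷ (g ∘ (0ℙ ∷_))) (∑ʷ (f ∘ (1ℙ ∷_))) (∑ʷ (g ∘ (1ℙ ∷_))))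
  where
  lem : ∀ a b c d → (a + b) + (c + d) ≡ (a + c) + (b + d)
  lem = solve-∀ ℚ-ring

∑ʷ-*ˡ : ∀ {k} q (f : Word k → ℚ) → ∑ʷ (λ x → q * f x) ≡ q * ∑ʷ f
∑ʷ-*ˡ {zero}  q f = refl
∑ʷ-*ˡ {suc k} q f = trans (cong₂ _+_ (∑ʷ-*ˡ q (f ∘ (0ℙ ∷_))) (∑ʷ-*ˡ q (f ∘ (1ℙ ∷_)))) (sym (ℚ.*-distribˡ-+ q (∑ʷ (f ∘ (0ℙ ∷_))) (∑ʷ (f ∘ (1ℙ ∷_)))))

∑ʷ-- : ∀ {k} (f g : Word k → ℚ) → ∑ʷ (λ x → f x - g x) ≡ ∑ʷ f - ∑ʷ g
∑ʷ-- {zero}  f g = refl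
∑ʷ-- {suc k} f g = trans (cong₂ _+_ (∑ʷ-- (f ∘ (0ℙ ∷_)) (g ∘ (0ℙ ∷_))) (∑ʷ-- (f ∘ (1ℙ ∷_)) (g ∘ (1ℙ ∷_)))) (lem (∑ʷ (f ∘ (0ℙ ∷_))) (∑ʷ (g ∘ (0ℙ ∷_))) (∑ʷ (f ∘ (1ℙ ∷_))) (∑ʷ (g ∘ (1ℙ ∷_))))
  where
  lem : ∀ a b c d → (a - b) + (c - d) ≡ (a + c) - (b + d)
  lem = solve-∀ ℚ-ring

∑ʷ-zero : ∀ {k} {f : Word k → ℚ} → (∀ x → f x ≡ 0ℚ) → ∑ʷ f ≡ 0ℚ
∑ʷ-zero {zero}  e = e []
∑ʷ-zero {suc k} e = cong₂ _+_ (∑ʷ-zero (e ∘ (0ℙ ∷_))) (∑ʷ-zero (e ∘ (1ℙ ∷_)))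

∑ʷ-comm : ∀ {k l} (f : Word k → Word l → ℚ) → ∑ʷ (λ x → ∑ʷ (f x)) ≡ ∑ʷ (λ y → ∑ʷ (λ x → f x y))
∑ʷ-comm {zero}  f = refl
∑ʷ-comm {suc k} f = trans (cong₂ _+_ (∑ʷ-comm (f ∘ (0ℙ ∷_))) (∑ʷ-comm (f ∘ (1ℙ ∷_))))
  (sym (∑ʷ-+ (λ y → ∑ʷ (λ x → f (0ℙ ∷ x) y)) (λ y → ∑ʷ (λ x → f (1ℙ ∷ x) y))))

-- Characters

sgn : 𝔽₂ → ℚ
sgn 0ℙ = 1ℚ
sgn 1ℙ = - 1ℚ

sgn-⁻¹ : ∀ p → sgn (p ℙ.⁻¹) ≡ - sgn p
sgn-⁻¹ 0ℙ = refl
sgn-⁻¹ 1ℙ = refl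

χ : ∀ {n} → Word n → Word n → ℚ
χ c x = sgn ⟨ c , x ⟩

_≟ʷ_ : ∀ {n} (x y : Word n) → Dec (x ≡ y)
_≟ʷ_ = ≡-dec ℙ._≟_

2^_ : ℕ → ℚ
2^ zero  = 1ℚ
2^ suc k = (1ℚ + 1ℚ) * 2^ k

2^≢0 : ∀ k → 2^ k ≢ 0ℚ
2^≢0 zero    ()
2^≢0 (suc k) = *-≢0 {1ℚ + 1ℚ} (λ ()) (2^≢0 k)

∑ʷ-χ : ∀ {k} (z : Word k) → ∑ʷ (λ a → χ a z) ≡ 2^ k * ⟦ z ≟ʷ 𝟎 k ⟧
∑ʷ-χ []           = refl
∑ʷ-χ {suc k} (0ℙ ∷ z) = begin
  ∑ʷ (λ a → χ a z) + ∑ʷ (λ a → χ a z) ≡⟨ cong₂ _+_ (∑ʷ-χ z) (∑ʷ-χ z) ⟩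
  2^ k * ⟦ z ≟ʷ 𝟎 k ⟧ + 2^ k * ⟦ z ≟ʷ 𝟎 k ⟧ ≡⟨ lem (2^ k) ⟦ z ≟ʷ 𝟎 k ⟧ ⟩
  2^ suc k * ⟦ z ≟ʷ 𝟎 k ⟧ ≡⟨ cong (2^ suc k *_) (⟦⟧-cong (z ≟ʷ 𝟎 k) ((0ℙ ∷ z) ≟ʷ 𝟎 (suc k)) (cong (0ℙ ∷_)) ∷-injectiveʳ) ⟩
  2^ suc k * ⟦ (0ℙ ∷ z) ≟ʷ 𝟎 (suc k) ⟧ ∎
  where
  lem : ∀ a b → a * b + a * b ≡ (1ℚ + 1ℚ) * a * b
  lem = solve-∀ ℚ-ring
∑ʷ-χ {suc k} (1ℙ ∷ z) = begin
  ∑ʷ (λ a → χ a z) + ∑ʷ (λ a → sgn (⟨ a , z ⟩ ℙ.⁻¹)) ≡⟨ ∑ʷ-+ (λ a → χ a z) (λ a → sgn (⟨ a , z ⟩ ℙ.⁻¹)) ⟨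
  ∑ʷ (λ a → χ a z + sgn (⟨ a , z ⟩ ℙ.⁻¹)) ≡⟨ ∑ʷ-zero (λ a → trans (cong (λ q → χ a z + q) (sgn-⁻¹ ⟨ a , z ⟩)) (ℚ.+-inverseʳ (χ a z))) ⟩
  0ℚ ≡⟨ ℚ.*-zeroʳ (2^ suc k) ⟨
  2^ suc k * 0ℚ ≡⟨ cong (2^ suc k *_) (⟦⟧-no ((1ℙ ∷ z) ≟ʷ 𝟎 (suc k)) λ ()) ⟨
  2^ suc k * ⟦ (1ℙ ∷ z) ≟ʷ 𝟎 (suc k) ⟧ ∎

⟨𝟎,⟩ : ∀ {n} (x : Word n) → ⟨ 𝟎 n , x ⟩ ≡ 0ℙ
⟨𝟎,⟩ []      = refl
⟨𝟎,⟩ (x ∷ xs) = ⟨𝟎,⟩ xs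

χ-𝟏 : ∀ {n} (x : Word n) → χ (𝟏 n) x ≡ -1^ (wt x)
χ-𝟏 []        = refl
χ-𝟏 (0ℙ ∷ xs) = χ-𝟏 xs
χ-𝟏 {suc n} (1ℙ ∷ xs) = trans (sgn-⁻¹ ⟨ 𝟏 n , xs ⟩) (cong -_ (χ-𝟏 xs))

wt≤n : ∀ {n} (x : Word n) → wt x ℕ.≤ n
wt≤n []        = ℕ.z≤n
wt≤n (0ℙ ∷ xs) = ℕ.m≤n⇒m≤1+n (wt≤n xs)
wt≤n (1ℙ ∷ xs) = ℕ.s≤s (wt≤n xs)

wt≡0⇒𝟎 : ∀ {n} (x : Word n) → wt x ≡ 0 → x ≡ 𝟎 n
wt≡0⇒𝟎 []        _ = refl
wt≡0⇒𝟎 (0ℙ ∷ xs) e = cong (0ℙ ∷_) (wt≡0⇒𝟎 xs e)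

wt≡n⇒𝟏 : ∀ {n} (x : Word n) → wt x ≡ n → x ≡ 𝟏 n
wt≡n⇒𝟏 []        _ = refl
wt≡n⇒𝟏 (0ℙ ∷ xs) e = contradiction (subst (ℕ._≤ _) e (wt≤n xs)) ℕ.1+n≰n
wt≡n⇒𝟏 (1ℙ ∷ xs) e = cong (1ℙ ∷_) (wt≡n⇒𝟏 xs (ℕ.suc-injective e))

wt-𝟎 : ∀ n → wt (𝟎 n) ≡ 0
wt-𝟎 zero    = refl
wt-𝟎 (suc n) = wt-𝟎 n

wt-𝟏⊕ : ∀ {n} (x : Word n) → wt (𝟏 n ⊕ x) ℕ.+ wt x ≡ n
wt-𝟏⊕ []        = refl
wt-𝟏⊕ (0ℙ ∷ xs) = cong suc (wt-𝟏⊕ xs)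
wt-𝟏⊕ (1ℙ ∷ xs) = trans (ℕ.+-suc _ _) (cong suc (wt-𝟏⊕ xs))

-- The adjacency operator of the Hamming cube

∑ⁿᵇ : ∀ {n} → Word n → (Word n → ℚ) → ℚ
∑ⁿᵇ []       f = 0ℚ
∑ⁿᵇ (x ∷ xs) f = f (x ℙ.⁻¹ ∷ xs) + ∑ⁿᵇ xs (f ∘ (x ∷_))

-- Characters are eigenfunctions: flipping a coordinate of `x` changes the sign of `χ c x` exactly
-- when it lies in the support of `c`, which gives (n - wt c) - wt c.
∑ⁿᵇ-χ : ∀ {n} (c x : Word n) → ∑ⁿᵇ x (χ c) ≡ χ c x * (↑ n - (1ℚ + 1ℚ) * ↑ (wt c))
∑ⁿᵇ-χ []       []       = refl
∑ⁿᵇ-χ {suc n} (0ℙ ∷ c) (x ∷ xs) = begin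
  χ c xs + ∑ⁿᵇ xs (χ c) ≡⟨ cong (χ c xs +_) (∑ⁿᵇ-χ c xs) ⟩
  χ c xs + χ c xs * (↑ n - (1ℚ + 1ℚ) * ↑ (wt c)) ≡⟨ lem (χ c xs) (↑ n) (↑ (wt c)) ⟩
  χ c xs * (1ℚ + ↑ n - (1ℚ + 1ℚ) * ↑ (wt c)) ≡⟨ cong (λ q → χ c xs * (q - (1ℚ + 1ℚ) * ↑ (wt c))) (↑-suc n) ⟨
  χ c xs * (↑ (suc n) - (1ℚ + 1ℚ) * ↑ (wt c)) ∎
  where
  lem : ∀ x n w → x + x * (n - (1ℚ + 1ℚ) * w) ≡ x * (1ℚ + n - (1ℚ + 1ℚ) * w)
  lem = solve-∀ ℚ-ring
∑ⁿᵇ-χ {suc n} (1ℙ ∷ c) (0ℙ ∷ xs) = begin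
  sgn (⟨ c , xs ⟩ ℙ.⁻¹) + ∑ⁿᵇ xs (χ c) ≡⟨ cong₂ _+_ (sgn-⁻¹ ⟨ c , xs ⟩) (∑ⁿᵇ-χ c xs) ⟩
  - χ c xs + χ c xs * (↑ n - (1ℚ + 1ℚ) * ↑ (wt c)) ≡⟨ lem (χ c xs) (↑ n) (↑ (wt c)) ⟩
  χ c xs * (1ℚ + ↑ n - (1ℚ + 1ℚ) * (1ℚ + ↑ (wt c))) ≡⟨ cong₂ (λ q r → χ c xs * (q - (1ℚ + 1ℚ) * r)) (↑-suc n) (↑-suc (wt c)) ⟨
  χ c xs * (↑ (suc n) - (1ℚ + 1ℚ) * ↑ (suc (wt c))) ∎
  where
  lem : ∀ x n w → - x + x * (n - (1ℚ + 1ℚ) * w) ≡ x * (1ℚ + n - (1ℚ + 1ℚ) * (1ℚ + w))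
  lem = solve-∀ ℚ-ring
∑ⁿᵇ-χ {suc n} (1ℙ ∷ c) (1ℙ ∷ xs) = begin
  χ c xs + ∑ⁿᵇ xs (χ (1ℙ ∷ c) ∘ (1ℙ ∷_)) ≡⟨ cong (χ c xs +_) (trans (∑ⁿᵇ-neg xs) (cong -_ (∑ⁿᵇ-χ c xs))) ⟩
  χ c xs + - (χ c xs * (↑ n - (1ℚ + 1ℚ) * ↑ (wt c))) ≡⟨ lem (χ c xs) (↑ n) (↑ (wt c)) ⟩
  - χ c xs * (1ℚ + ↑ n - (1ℚ + 1ℚ) * (1ℚ + ↑ (wt c))) ≡⟨ cong₂ (λ q r → - χ c xs * (q - (1ℚ + 1ℚ) * r)) (↑-suc n) (↑-suc (wt c)) ⟨
  - χ c xs * (↑ (suc n) - (1ℚ + 1ℚ) * ↑ (suc (wt c))) ≡⟨ cong (_* (↑ (suc n) - (1ℚ + 1ℚ) * ↑ (suc (wt c)))) (sgn-⁻¹ ⟨ c , xs ⟩) ⟨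
  χ (1ℙ ∷ c) (1ℙ ∷ xs) * (↑ (suc n) - (1ℚ + 1ℚ) * ↑ (suc (wt c))) ∎
  where
  lem : ∀ x n w → x + - (x * (n - (1ℚ + 1ℚ) * w)) ≡ - x * (1ℚ + n - (1ℚ + 1ℚ) * (1ℚ + w))
  lem = solve-∀ ℚ-ring
  gen : ∀ {m} (y : Word m) (f g : Word m → ℚ) → (∀ z → f z ≡ - g z) → ∑ⁿᵇ y f ≡ - ∑ⁿᵇ y g
  gen []       f g e = refl
  gen (y ∷ ys) f g e = trans (cong₂ _+_ (e _) (gen ys _ _ (e ∘ (y ∷_)))) (sym (ℚ.neg-distrib-+ (g (y ℙ.⁻¹ ∷ ys)) (∑ⁿᵇ ys (g ∘ (y ∷_)))))
  ∑ⁿᵇ-neg : ∀ y → ∑ⁿᵇ y (χ (1ℙ ∷ c) ∘ (1ℙ ∷_)) ≡ - ∑ⁿᵇ y (χ c)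
  ∑ⁿᵇ-neg y = gen y _ _ (λ z → sgn-⁻¹ ⟨ c , z ⟩)

-- Of the neighbours of `x`, `wt x` lose a point and `n - wt x` gain one. The assumption on `f`
-- stops at weight `wt x + 1` because it will be applied to functions that are radial on small
-- weights only.
∑ⁿᵇ-radial : ∀ {n} (x : Word n) (f : Word n → ℚ) (γ : ℕ → ℚ) →
  (∀ y → wt y ℕ.≤ suc (wt x) → f y ≡ γ (wt y)) →
  ∑ⁿᵇ x f ≡ ↑ (wt x) * γ (wt x ∸ 1) + (↑ n - ↑ (wt x)) * γ (suc (wt x))
∑ⁿᵇ-radial []        f γ e = lem (γ 0) (γ 1)
  where
  lem : ∀ a b → 0ℚ ≡ 0ℚ * a + (0ℚ - 0ℚ) * b
  lem = solve-∀ ℚ-ring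
∑ⁿᵇ-radial {suc n} (0ℙ ∷ xs) f γ e = begin
  f (1ℙ ∷ xs) + ∑ⁿᵇ xs (f ∘ (0ℙ ∷_)) ≡⟨ cong₂ _+_ (e _ ℕ.≤-refl) (∑ⁿᵇ-radial xs (f ∘ (0ℙ ∷_)) γ (λ y → e (0ℙ ∷ y))) ⟩
  γ (suc w) + (↑ w * γ (w ∸ 1) + (↑ n - ↑ w) * γ (suc w)) ≡⟨ lem (γ (suc w)) (γ (w ∸ 1)) (↑ w) (↑ n) ⟩
  ↑ w * γ (w ∸ 1) + (1ℚ + ↑ n - ↑ w) * γ (suc w) ≡⟨ cong (λ q → ↑ w * γ (w ∸ 1) + (q - ↑ w) * γ (suc w)) (↑-suc n) ⟨
  ↑ w * γ (w ∸ 1) + (↑ (suc n) - ↑ w) * γ (suc w) ∎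
  where
  w = wt xs
  lem : ∀ a b w n → a + (w * b + (n - w) * a) ≡ w * b + (1ℚ + n - w) * a
  lem = solve-∀ ℚ-ring
∑ⁿᵇ-radial {suc n} (1ℙ ∷ xs) f γ e = begin
  f (0ℙ ∷ xs) + ∑ⁿᵇ xs (f ∘ (1ℙ ∷_))
    ≡⟨ cong₂ _+_ (e (0ℙ ∷ xs) (ℕ.m≤n⇒m≤1+n (ℕ.n≤1+n w))) (∑ⁿᵇ-radial xs (f ∘ (1ℙ ∷_)) (γ ∘ suc) (λ y → e (1ℙ ∷ y) ∘ ℕ.s≤s)) ⟩
  γ w + (↑ w * γ (suc (w ∸ 1)) + (↑ n - ↑ w) * γ (suc (suc w)))
    ≡⟨ cong (λ q → γ w + (q + (↑ n - ↑ w) * γ (suc (suc w)))) (shift-back w) ⟩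
  γ w + (↑ w * γ w + (↑ n - ↑ w) * γ (suc (suc w))) ≡⟨ lem (γ w) (γ (suc (suc w))) (↑ w) (↑ n) ⟩
  (1ℚ + ↑ w) * γ w + (1ℚ + ↑ n - (1ℚ + ↑ w)) * γ (suc (suc w))
    ≡⟨ cong₂ (λ p q → p * γ w + (q - p) * γ (suc (suc w))) (↑-suc w) (↑-suc n) ⟨
  ↑ (suc w) * γ w + (↑ (suc n) - ↑ (suc w)) * γ (suc (suc w)) ∎
  where
  w = wt xs
  lem : ∀ a b w n → a + (w * a + (n - w) * b) ≡ (1ℚ + w) * a + (1ℚ + n - (1ℚ + w)) * b
  lem = solve-∀ ℚ-ring
  -- At `w = 0` the truncated `w ∸ 1` gives the wrong argument of `γ`, but there the coefficient is
  -- 0.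
  shift-back : ∀ w → ↑ w * γ (suc (w ∸ 1)) ≡ ↑ w * γ w
  shift-back zero    = trans (ℚ.*-zeroˡ (γ 1)) (sym (ℚ.*-zeroˡ (γ 0)))
  shift-back (suc w) = refl

∑ⁿᵇ-∑ʷ : ∀ {n k} (x : Word n) (f : Word k → Word n → ℚ) →
  ∑ⁿᵇ x (λ y → ∑ʷ (λ a → f a y)) ≡ ∑ʷ (λ a → ∑ⁿᵇ x (f a))
∑ⁿᵇ-∑ʷ {k = k} [] f = sym (∑ʷ-zero {k} (λ _ → refl))
∑ⁿᵇ-∑ʷ (x ∷ xs) f = trans (cong (∑ʷ (λ a → f a (x ℙ.⁻¹ ∷ xs)) +_) (∑ⁿᵇ-∑ʷ xs (λ a → f a ∘ (x ∷_))))
  (sym (∑ʷ-+ (λ a → f a (x ℙ.⁻¹ ∷ xs)) (λ a → ∑ⁿᵇ xs (f a ∘ (x ∷_)))))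

∑ⁿᵇ-*ʳ : ∀ {n} (x : Word n) (f : Word n → ℚ) q → ∑ⁿᵇ x (λ y → f y * q) ≡ ∑ⁿᵇ x f * q
∑ⁿᵇ-*ʳ []       f q = sym (ℚ.*-zeroˡ q)
∑ⁿᵇ-*ʳ (x ∷ xs) f q = trans (cong (f (x ℙ.⁻¹ ∷ xs) * q +_) (∑ⁿᵇ-*ʳ xs (f ∘ (x ∷_)) q)) (sym (ℚ.*-distribʳ-+ q (f (x ℙ.⁻¹ ∷ xs)) (∑ⁿᵇ xs (f ∘ (x ∷_)))))

-- Bases and syndromes

⟨,𝟎⟩ : ∀ {n} (x : Word n) → ⟨ x , 𝟎 n ⟩ ≡ 0ℙ
⟨,𝟎⟩ []        = refl
⟨,𝟎⟩ (0ℙ ∷ xs) = ⟨,𝟎⟩ xs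
⟨,𝟎⟩ (1ℙ ∷ xs) = ⟨,𝟎⟩ xs

tabulate-⊕ : ∀ {n} (x : Word n) (g : Fin n → 𝔽₂) → tabulate (λ j → lookup x j ℙ.+ g j) ≡ x ⊕ tabulate g
tabulate-⊕ []       g = refl
tabulate-⊕ (x ∷ xs) g = cong (x ℙ.+ g zero ∷_) (tabulate-⊕ xs (g ∘ suc))

tabulate-𝟎 : ∀ n → tabulate {n = n} (λ _ → 0ℙ) ≡ 𝟎 n
tabulate-𝟎 zero    = refl
tabulate-𝟎 (suc n) = cong (0ℙ ∷_) (tabulate-𝟎 n)

linearCombination-closed : ∀ {n k} {C : Pred (Word n) 0ℓ} → IsSubspace C → (b : Fin k → Word n) →
  (∀ i → C (b i)) → ∀ a → C (linearCombination a b)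
linearCombination-closed {n} {C = C} C-sub b b∈C [] = subst C (sym (tabulate-𝟎 n)) (IsSubspace.𝟎-closed C-sub)
linearCombination-closed C-sub b b∈C (0ℙ ∷ a) = linearCombination-closed C-sub (b ∘ suc) (b∈C ∘ suc) a
linearCombination-closed {C = C} C-sub b b∈C (1ℙ ∷ a) =
  subst C (sym (tabulate-⊕ (b zero) _))
    (IsSubspace.⊕-closed C-sub (b∈C zero) (linearCombination-closed C-sub (b ∘ suc) (b∈C ∘ suc) a))

-- The syndrome of `x`: basis vectors of C are the rows of a parity-check matrix for the dual, so it
-- vanishes exactly on the dual and makes membership there decidable.
gram : ∀ {n k} → (Fin k → Word n) → Word n → Word k
gram b x = tabulate λ i → ⟨ b i , x ⟩

⟨linearCombination,⟩ : ∀ {n k} (a : Word k) (b : Fin k → Word n) (x : Word n) →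
  ⟨ linearCombination a b , x ⟩ ≡ ⟨ a , gram b x ⟩
⟨linearCombination,⟩ {n} {k} a b x = begin
  sum (λ j → lookup (linearCombination a b) j ℙ.* lookup x j)
    ≡⟨ sum-cong-≗ (λ j → cong (ℙ._* lookup x j) (lookup∘tabulate (λ j → sum (λ i → lookup a i ℙ.* lookup (b i) j)) j)) ⟩
  sum (λ j → sum (λ i → lookup a i ℙ.* lookup (b i) j) ℙ.* lookup x j)
    ≡⟨ sum-cong-≗ (λ j → *-distribʳ-sum (lookup x j) (λ i → lookup a i ℙ.* lookup (b i) j)) ⟩
  sum (λ j → sum (λ i → lookup a i ℙ.* lookup (b i) j ℙ.* lookup x j))
    ≡⟨ ∑-comm (λ j i → lookup a i ℙ.* lookup (b i) j ℙ.* lookup x j) ⟩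
  sum (λ i → sum (λ j → lookup a i ℙ.* lookup (b i) j ℙ.* lookup x j))
    ≡⟨ sum-cong-≗ (λ i → trans (sum-cong-≗ (λ j → ℙ.*-assoc (lookup a i) (lookup (b i) j) (lookup x j)))
                               (sym (*-distribˡ-sum (lookup a i) (λ j → lookup (b i) j ℙ.* lookup x j)))) ⟩
  sum (λ i → lookup a i ℙ.* ⟨ b i , x ⟩)
    ≡⟨ sum-cong-≗ (λ i → cong (lookup a i ℙ.*_) (lookup∘tabulate (λ i → ⟨ b i , x ⟩) i)) ⟨
  ⟨ a , gram b x ⟩ ∎

-- Lists of weights and polynomials with prescribed roots

∑ᴸ : List ℕ → (ℕ → ℚ) → ℚ
∑ᴸ []       f = 0ℚ
∑ᴸ (u ∷ us) f = f u + ∑ᴸ us f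

∑ᴸ-zero : ∀ us {f : ℕ → ℚ} → (∀ {u} → u ∈ us → f u ≡ 0ℚ) → ∑ᴸ us f ≡ 0ℚ
∑ᴸ-zero []       e = refl
∑ᴸ-zero (u ∷ us) e = cong₂ _+_ (e (here refl)) (∑ᴸ-zero us (e ∘ there))

∑ᴸ-∑ʷ : ∀ {k} us (f : ℕ → Word k → ℚ) → ∑ʷ (λ a → ∑ᴸ us (λ u → f u a)) ≡ ∑ᴸ us (λ u → ∑ʷ (f u))
∑ᴸ-∑ʷ {k} [] f = ∑ʷ-zero {k} (λ _ → refl)
∑ᴸ-∑ʷ (u ∷ us) f = trans (∑ʷ-+ (f u) (λ a → ∑ᴸ us (λ u → f u a))) (cong (∑ʷ (f u) +_) (∑ᴸ-∑ʷ us f))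

at : ℕ → ℕ → ℚ
at u m = ⟦ m ℕ.≟ u ⟧

-- On `us`, `f` is a combination of the point indicators. The factor `q` will be a difference of two
-- characters; it sits next to the indicator so that exchanging sums yields differences of `F` at
-- `at u`.
interpolate : ∀ {us m} (f : ℕ → ℚ) q → Unique us → m ∈ us → q * f m ≡ ∑ᴸ us (λ u → f u * (q * at u m))
interpolate {u ∷ us} {m} f q (u∉ ∷ _) (here refl) = begin
  q * f u              ≡⟨ lem q (f u) ⟩
  f u * (q * 1ℚ) + 0ℚ  ≡⟨ cong₂ (λ r s → f u * (q * r) + s) (⟦⟧-yes (u ℕ.≟ u) refl) (∑ᴸ-zero us off) ⟨
  f u * (q * at u u) + ∑ᴸ us (λ v → f v * (q * at v u)) ∎
  where
  lem : ∀ q r → q * r ≡ r * (q * 1ℚ) + 0ℚ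
  lem = solve-∀ ℚ-ring
  lem₀ : ∀ q r → q * (r * 0ℚ) ≡ 0ℚ
  lem₀ = solve-∀ ℚ-ring
  off : ∀ {v} → v ∈ us → f v * (q * at v u) ≡ 0ℚ
  off {v} v∈ = trans (cong (λ r → f v * (q * r)) (⟦⟧-no (u ℕ.≟ v) (All.lookup u∉ v∈))) (lem₀ (f v) q)
interpolate {u ∷ us} {m} f q (u∉ ∷ uniq) (there m∈) = begin
  q * f m                     ≡⟨ interpolate f q uniq m∈ ⟩
  s                           ≡⟨ lem (f u) q s ⟩
  f u * (q * 0ℚ) + s          ≡⟨ cong (λ r → f u * (q * r) + s) (⟦⟧-no (m ℕ.≟ u) (All.lookup u∉ m∈ ∘ sym)) ⟨
  f u * (q * at u m) + s ∎
  where
  s = ∑ᴸ us (λ v → f v * (q * at v m))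
  lem : ∀ a b c → c ≡ a * (b * 0ℚ) + c
  lem = solve-∀ ℚ-ring

remove : ∀ {u : ℕ} {xs : List ℕ} → Unique xs → u ∈ xs → ∃[ ys ] length xs ≡ suc (length ys) × u ∉ ys ×
  (∀ {v} → v ∈ xs → v ∈ u ∷ ys) × Unique ys × (∀ {v} → v ∈ ys → v ∈ xs)
remove {u} {_ ∷ xs} (u∉ ∷ xs!) (here refl) = xs , refl , (λ u∈ → All.lookup u∉ u∈ refl) , id , xs! , there
remove {u} {x ∷ xs} (x∉ ∷ xs!) (there u∈) with remove xs! u∈
... | ys , len , u∉ys , split , ys! , ys⊆ = x ∷ ys , cong suc len , u∉ , split′ , (All.tabulate (All.lookup x∉ ∘ ys⊆) ∷ ys!) , ⊆′
  where
  u∉ : u ∉ x ∷ ys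
  u∉ (here e)  = All.lookup x∉ u∈ (sym e)
  u∉ (there m) = u∉ys m
  split′ : ∀ {v} → v ∈ x ∷ xs → v ∈ u ∷ x ∷ ys
  split′ (here e) = there (here e)
  split′ (there m) with split m
  ... | here e  = here e
  ... | there m = there (there m)
  ⊆′ : ∀ {v} → v ∈ x ∷ ys → v ∈ x ∷ xs
  ⊆′ (here e)  = here e
  ⊆′ (there m) = there (ys⊆ m)

-- The factor 2 makes each linear factor equal to (n - 2u) - (n - 2v): an eigenvalue of the
-- adjacency operator minus a constant.
poly : List ℕ → ℕ → ℚ
poly []      u = 1ℚ
poly (v ∷ L) u = ((1ℚ + 1ℚ) * (↑ v - ↑ u)) * poly L u

poly-root : ∀ {L u} → u ∈ L → poly L u ≡ 0ℚ
poly-root {v ∷ L} (here refl) = lem (↑ v) (poly L v)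
  where
  lem : ∀ a b → ((1ℚ + 1ℚ) * (a - a)) * b ≡ 0ℚ
  lem = solve-∀ ℚ-ring
poly-root {v ∷ L} {u} (there u∈) = trans (cong (((1ℚ + 1ℚ) * (↑ v - ↑ u)) *_) (poly-root u∈)) (ℚ.*-zeroʳ ((1ℚ + 1ℚ) * (↑ v - ↑ u)))

poly≢0 : ∀ {L u} → u ∉ L → poly L u ≢ 0ℚ
poly≢0 {[]}    u∉ ()
poly≢0 {v ∷ L} {u} u∉ = *-≢0 (*-≢0 {1ℚ + 1ℚ} (λ ()) (λ e → u∉ (here (sym (↑-injective (x-y≡0⇒x≡y e))))))
  (poly≢0 (u∉ ∘ there))

-- Character sums over the codewords

module Code {n k} (C : Pred (Word n) 0ℓ) (C-sub : IsSubspace C) (b : Fin k → Word n) (b-basis : IsBasis C b) where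

  private
    cw : Word k → Word n
    cw a = linearCombination a b

  cw∈C : ∀ a → C (cw a)
  cw∈C = linearCombination-closed C-sub b (IsBasis.member b-basis)

  ⊥⇒gram : ∀ {x} → (C ⊥) x → gram b x ≡ 𝟎 k
  ⊥⇒gram {x} x∈ = trans (tabulate-cong (λ i → x∈ (b i) (IsBasis.member b-basis i))) (tabulate-𝟎 k)

  gram⇒⊥ : ∀ {x} → gram b x ≡ 𝟎 k → (C ⊥) x
  gram⇒⊥ {x} e c c∈ with IsBasis.spanning b-basis c∈
  ... | a , refl = trans (⟨linearCombination,⟩ a b x) (trans (cong ⟨ a ,_⟩ e) (⟨,𝟎⟩ a))

  ⊥? : ∀ x → Dec ((C ⊥) x)
  ⊥? x = map′ (gram⇒⊥ {x}) (⊥⇒gram {x}) (gram b x ≟ʷ 𝟎 k)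

  ∑χ : ∀ x → ∑ʷ (λ a → χ (cw a) x) ≡ 2^ k * ⟦ ⊥? x ⟧
  ∑χ x = begin
    ∑ʷ (λ a → χ (cw a) x)       ≡⟨ ∑ʷ-cong (λ a → cong sgn (⟨linearCombination,⟩ a b x)) ⟩
    ∑ʷ (λ a → χ a (gram b x))   ≡⟨ ∑ʷ-χ (gram b x) ⟩
    2^ k * ⟦ gram b x ≟ʷ 𝟎 k ⟧  ≡⟨ cong (2^ k *_) (⟦⟧-cong (gram b x ≟ʷ 𝟎 k) (⊥? x) (gram⇒⊥ {x}) (⊥⇒gram {x})) ⟩
    2^ k * ⟦ ⊥? x ⟧ ∎

  -- Codewords are enumerated through their coefficient vectors with respect to the basis, which
  -- form an explicit finite set.
  F : Word n → (ℕ → ℚ) → ℚ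
  F x φ = ∑ʷ λ a → χ (cw a) x * φ (wt (cw a))

  F-diff : ∀ x y φ → F x φ - F y φ ≡ ∑ʷ (λ a → (χ (cw a) x - χ (cw a) y) * φ (wt (cw a)))
  F-diff x y φ = trans (sym (∑ʷ-- (λ a → χ (cw a) x * φ (wt (cw a))) (λ a → χ (cw a) y * φ (wt (cw a)))))
    (∑ʷ-cong (λ a → lem (χ (cw a) x) (χ (cw a) y) (φ (wt (cw a)))))
    where
    lem : ∀ a b c → a * c - b * c ≡ (a - b) * c
    lem = solve-∀ ℚ-ring

  F-∑ⁿᵇ : ∀ x φ → ∑ⁿᵇ x (λ y → F y φ) ≡ F x (λ u → (↑ n - (1ℚ + 1ℚ) * ↑ u) * φ u)
  F-∑ⁿᵇ x φ = trans (∑ⁿᵇ-∑ʷ x (λ a y → χ (cw a) y * φ (wt (cw a)))) (∑ʷ-cong (λ a →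
    trans (∑ⁿᵇ-*ʳ x (χ (cw a)) (φ (wt (cw a))))
      (trans (cong (_* φ (wt (cw a))) (∑ⁿᵇ-χ (cw a) x)) (ℚ.*-assoc (χ (cw a) x) (↑ n - (1ℚ + 1ℚ) * ↑ (wt (cw a))) (φ (wt (cw a)))))))

  F-poly-∷ : ∀ x v L → F x (poly (v ∷ L)) ≡ ∑ⁿᵇ x (λ y → F y (poly L)) - (↑ n - (1ℚ + 1ℚ) * ↑ v) * F x (poly L)
  F-poly-∷ x v L = begin
    F x (poly (v ∷ L))
      ≡⟨ ∑ʷ-cong (λ a → lem (χ (cw a) x) (↑ n) (↑ v) (↑ (wt (cw a))) (poly L (wt (cw a)))) ⟩
    ∑ʷ (λ a → χ (cw a) x * ((↑ n - (1ℚ + 1ℚ) * ↑ (wt (cw a))) * poly L (wt (cw a)))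
              - (↑ n - (1ℚ + 1ℚ) * ↑ v) * (χ (cw a) x * poly L (wt (cw a))))
      ≡⟨ ∑ʷ-- (λ a → χ (cw a) x * ((↑ n - (1ℚ + 1ℚ) * ↑ (wt (cw a))) * poly L (wt (cw a))))
              (λ a → (↑ n - (1ℚ + 1ℚ) * ↑ v) * (χ (cw a) x * poly L (wt (cw a)))) ⟩
    F x (λ u → (↑ n - (1ℚ + 1ℚ) * ↑ u) * poly L u) - ∑ʷ (λ a → (↑ n - (1ℚ + 1ℚ) * ↑ v) * (χ (cw a) x * poly L (wt (cw a))))
      ≡⟨ cong₂ _-_ (sym (F-∑ⁿᵇ x (poly L))) (∑ʷ-*ˡ (↑ n - (1ℚ + 1ℚ) * ↑ v) (λ a → χ (cw a) x * poly L (wt (cw a)))) ⟩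
    ∑ⁿᵇ x (λ y → F y (poly L)) - (↑ n - (1ℚ + 1ℚ) * ↑ v) * F x (poly L) ∎
    where
    lem : ∀ c n v u p → c * (((1ℚ + 1ℚ) * (v - u)) * p) ≡ c * ((n - (1ℚ + 1ℚ) * u) * p) - (n - (1ℚ + 1ℚ) * v) * (c * p)
    lem = solve-∀ ℚ-ring

  module Strength {d⊥} (d⊥-min : ∀ {x} → (C ⊥) x → x ≢ 𝟎 n → d⊥ ℕ.≤ wt x) where

    -- For the constant polynomial the sum is `2^ k` times the indicator of the dual, which contains
    -- only `𝟎` below weight `d⊥`. Each further root costs one passage to the neighbours, so it
    -- needs the previous claim at weight `wt x + 1`; the bound on `wt x + length L` is invariant
    -- under this trade.
    F-poly-radial : ∀ L → ∃[ γ ] ∀ x → wt x ℕ.+ length L ℕ.< d⊥ → F x (poly L) ≡ γ (wt x)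
    F-poly-radial [] = (λ w → 2^ k * ⟦ w ℕ.≟ 0 ⟧) , λ x x< → begin
      F x (poly [])           ≡⟨ ∑ʷ-cong (λ a → ℚ.*-identityʳ (χ (cw a) x)) ⟩
      ∑ʷ (λ a → χ (cw a) x)   ≡⟨ ∑χ x ⟩
      2^ k * ⟦ ⊥? x ⟧         ≡⟨ cong (2^ k *_) (⟦⟧-cong (⊥? x) (wt x ℕ.≟ 0) (to x x<) (from x)) ⟩
      2^ k * ⟦ wt x ℕ.≟ 0 ⟧   ∎
      where
      to : ∀ x → wt x ℕ.+ 0 ℕ.< d⊥ → (C ⊥) x → wt x ≡ 0
      to x x< x∈ with x ≟ʷ 𝟎 n
      ... | yes refl = wt-𝟎 n
      ... | no x≢0   = contradiction (d⊥-min x∈ x≢0) (ℕ.<⇒≱ (subst (ℕ._< d⊥) (ℕ.+-identityʳ (wt x)) x<))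
      from : ∀ x → wt x ≡ 0 → (C ⊥) x
      from x e c _ = trans (cong ⟨ c ,_⟩ (wt≡0⇒𝟎 x e)) (⟨,𝟎⟩ c)
    F-poly-radial (v ∷ L) with F-poly-radial L
    ... | γ , e = γ′ , λ x x< → let x<′ = subst (ℕ._< d⊥) (ℕ.+-suc (wt x) (length L)) x< in begin
      F x (poly (v ∷ L)) ≡⟨ F-poly-∷ x v L ⟩
      ∑ⁿᵇ x (λ y → F y (poly L)) - (↑ n - (1ℚ + 1ℚ) * ↑ v) * F x (poly L)
        ≡⟨ cong₂ (λ p q → p - (↑ n - (1ℚ + 1ℚ) * ↑ v) * q)
             (∑ⁿᵇ-radial x (λ y → F y (poly L)) γ (λ y y≤ → e y (ℕ.≤-<-trans (ℕ.+-monoˡ-≤ (length L) y≤) x<′)))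
             (e x (ℕ.≤-<-trans (ℕ.n≤1+n _) x<′)) ⟩
      γ′ (wt x) ∎
      where
      γ′ : ℕ → ℚ
      γ′ w = ↑ w * γ (w ∸ 1) + (↑ n - ↑ w) * γ (suc w) - (↑ n - (1ℚ + 1ℚ) * ↑ v) * γ w

    module Pair (x y : Word n) (wt≡ : wt x ≡ wt y) where

      F-poly-≡ : ∀ L → wt x ℕ.+ length L ℕ.< d⊥ → F x (poly L) ≡ F y (poly L)
      F-poly-≡ L x< with F-poly-radial L
      ... | γ , e = trans (e x x<) (trans (cong γ wt≡) (sym (e y (subst (λ w → w ℕ.+ length L ℕ.< d⊥) wt≡ x<))))

      -- Words at which the two characters agree cancel in the difference. On the others `poly L`
      -- vanishes unless the weight is `u`, where it is a nonzero constant that can be divided out.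
      F-at-≡ : ∀ {u L} → wt x ℕ.+ length L ℕ.< d⊥ → u ∉ L →
        (∀ a → χ (cw a) x ≡ χ (cw a) y ⊎ wt (cw a) ∈ u ∷ L) → F x (at u) ≡ F y (at u)
      F-at-≡ {u} {L} x< u∉ cover = x-y≡0⇒x≡y (x*y≡0⇒y≡0 (poly≢0 u∉) (begin
        poly L u * (F x (at u) - F y (at u)) ≡⟨ cong (poly L u *_) (F-diff x y (at u)) ⟩
        poly L u * ∑ʷ (λ a → (χ (cw a) x - χ (cw a) y) * at u (wt (cw a)))
          ≡⟨ ∑ʷ-*ˡ (poly L u) (λ a → (χ (cw a) x - χ (cw a) y) * at u (wt (cw a))) ⟨
        ∑ʷ (λ a → poly L u * ((χ (cw a) x - χ (cw a) y) * at u (wt (cw a)))) ≡⟨ ∑ʷ-cong term ⟨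
        ∑ʷ (λ a → (χ (cw a) x - χ (cw a) y) * poly L (wt (cw a))) ≡⟨ F-diff x y (poly L) ⟨
        F x (poly L) - F y (poly L) ≡⟨ x≡y⇒x-y≡0 (F-poly-≡ L x<) ⟩
        0ℚ ∎))
        where
        cancel : ∀ {p q} r s t → p ≡ q → (p - q) * r ≡ s * ((p - q) * t)
        cancel {p} r s t refl = lem p r s t
          where
          lem : ∀ p r s t → (p - p) * r ≡ s * ((p - p) * t)
          lem = solve-∀ ℚ-ring
        one : ∀ p q → p * q ≡ q * (p * 1ℚ)
        one = solve-∀ ℚ-ring
        none : ∀ p q → p * 0ℚ ≡ q * (p * 0ℚ)
        none = solve-∀ ℚ-ring
        term : ∀ a → (χ (cw a) x - χ (cw a) y) * poly L (wt (cw a)) ≡ poly L u * ((χ (cw a) x - χ (cw a) y) * at u (wt (cw a)))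
        term a with cover a
        ... | inj₁ e = cancel (poly L (wt (cw a))) (poly L u) (at u (wt (cw a))) e
        ... | inj₂ (here e) = begin
          h * poly L (wt (cw a)) ≡⟨ cong (λ m → h * poly L m) e ⟩
          h * poly L u           ≡⟨ one h (poly L u) ⟩
          poly L u * (h * 1ℚ)    ≡⟨ cong (λ q → poly L u * (h * q)) (⟦⟧-yes (wt (cw a) ℕ.≟ u) e) ⟨
          poly L u * (h * at u (wt (cw a))) ∎
          where h = χ (cw a) x - χ (cw a) y
        ... | inj₂ (there m) = begin
          h * poly L (wt (cw a)) ≡⟨ cong (h *_) (poly-root m) ⟩
          h * 0ℚ                 ≡⟨ none h (poly L u) ⟩
          poly L u * (h * 0ℚ)    ≡⟨ cong (λ q → poly L u * (h * q)) (⟦⟧-no (wt (cw a) ℕ.≟ u) (λ e → u∉ (subst (_∈ L) e m))) ⟨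
          poly L u * (h * at u (wt (cw a))) ∎
          where h = χ (cw a) x - χ (cw a) y

      -- Only the values of `φ` on `us` can be seen by the difference, since elsewhere the
      -- characters agree.
      F-expand : ∀ {us} → Unique us → (∀ a → χ (cw a) x ≡ χ (cw a) y ⊎ wt (cw a) ∈ us) → ∀ φ →
        F x φ - F y φ ≡ ∑ᴸ us (λ u → φ u * (F x (at u) - F y (at u)))
      F-expand {us} uniq cover φ = begin
        F x φ - F y φ ≡⟨ F-diff x y φ ⟩
        ∑ʷ (λ a → (χ (cw a) x - χ (cw a) y) * φ (wt (cw a))) ≡⟨ ∑ʷ-cong term ⟩
        ∑ʷ (λ a → ∑ᴸ us (λ u → φ u * ((χ (cw a) x - χ (cw a) y) * at u (wt (cw a)))))
          ≡⟨ ∑ᴸ-∑ʷ us (λ u a → φ u * ((χ (cw a) x - χ (cw a) y) * at u (wt (cw a)))) ⟩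
        ∑ᴸ us (λ u → ∑ʷ (λ a → φ u * ((χ (cw a) x - χ (cw a) y) * at u (wt (cw a))))) ≡⟨ ∑ᴸ-cong us (λ u →
          trans (∑ʷ-*ˡ (φ u) (λ a → (χ (cw a) x - χ (cw a) y) * at u (wt (cw a)))) (cong (φ u *_) (sym (F-diff x y (at u))))) ⟩
        ∑ᴸ us (λ u → φ u * (F x (at u) - F y (at u))) ∎
        where
        ∑ᴸ-cong : ∀ us {f g : ℕ → ℚ} → (∀ u → f u ≡ g u) → ∑ᴸ us f ≡ ∑ᴸ us g
        ∑ᴸ-cong []       e = refl
        ∑ᴸ-cong (u ∷ us) e = cong₂ _+_ (e u) (∑ᴸ-cong us e)
        lem₀ : ∀ q r s → s * ((q - q) * r) ≡ 0ℚ
        lem₀ = solve-∀ ℚ-ring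
        term : ∀ a → (χ (cw a) x - χ (cw a) y) * φ (wt (cw a)) ≡ ∑ᴸ us (λ u → φ u * ((χ (cw a) x - χ (cw a) y) * at u (wt (cw a))))
        term a with cover a
        ... | inj₂ m = interpolate φ (χ (cw a) x - χ (cw a) y) uniq m
        ... | inj₁ e rewrite e = trans (lem₁ (χ (cw a) y) (φ (wt (cw a)))) (sym (∑ᴸ-zero us (λ {u} _ → lem₀ (χ (cw a) y) (at u (wt (cw a))) (φ u))))
          where
          lem₁ : ∀ q r → (q - q) * r ≡ 0ℚ
          lem₁ = solve-∀ ℚ-ring

      -- Each weight in turn is isolated by the polynomial whose roots are the other members of
      -- `us`, so the degree is one less than the length; this is why the bound is not strict.
      F-const : ∀ {us} → Unique us → (∀ a → χ (cw a) x ≡ χ (cw a) y ⊎ wt (cw a) ∈ us) → wt x ℕ.+ length us ℕ.≤ d⊥ →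
        ∀ φ → F x φ ≡ F y φ
      F-const {us} us! cover x≤ φ = x-y≡0⇒x≡y (trans (F-expand us! cover φ) (∑ᴸ-zero us term))
        where
        term : ∀ {u} → u ∈ us → φ u * (F x (at u) - F y (at u)) ≡ 0ℚ
        term {u} u∈ with remove us! u∈
        ... | L , len , u∉ , split , _ = trans
          (cong (φ u *_) (x≡y⇒x-y≡0 (F-at-≡
            (ℕ.≤-trans (ℕ.≤-reflexive (trans (sym (ℕ.+-suc (wt x) (length L))) (cong (wt x ℕ.+_) (sym len)))) x≤)
            u∉ (λ a → [ inj₁ , inj₂ ∘ split ]′ (cover a)))))
          (ℚ.*-zeroʳ (φ u))

-- Formal power series

Seq : Set
Seq = ℕ → ℚ

shift : Seq → Seq
shift f zero    = 0ℚ
shift f (suc j) = f j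

-- Multiplication by `1 + z`, `1 - z`, `1 - z²` and their powers enters only through linear
-- operators built from `shift`.
record IsLinear (op : Seq → Seq) : Set where
  field
    op-cong : ∀ {f g} → f ≗ g → op f ≗ op g
    op-+    : ∀ f g j → op (λ i → f i + g i) j ≡ op f j + op g j
    op-*    : ∀ q f j → op (λ i → q * f i) j ≡ q * op f j

  op-zero : ∀ {f} → (∀ i → f i ≡ 0ℚ) → ∀ j → op f j ≡ 0ℚ
  op-zero {f} e j = begin
    op f j                ≡⟨ op-cong (λ i → trans (e i) (sym (ℚ.*-zeroˡ (f i)))) j ⟩
    op (λ i → 0ℚ * f i) j ≡⟨ op-* 0ℚ f j ⟩
    0ℚ * op f j           ≡⟨ ℚ.*-zeroˡ (op f j) ⟩
    0ℚ ∎

  op-- : ∀ f g j → op (λ i → f i - g i) j ≡ op f j - op g j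
  op-- f g j = begin
    op (λ i → f i - g i) j             ≡⟨ op-cong (λ i → lem (f i) (g i)) j ⟩
    op (λ i → f i + (- 1ℚ) * g i) j    ≡⟨ op-+ f (λ i → (- 1ℚ) * g i) j ⟩
    op f j + op (λ i → (- 1ℚ) * g i) j ≡⟨ cong (op f j +_) (op-* (- 1ℚ) g j) ⟩
    op f j + (- 1ℚ) * op g j           ≡⟨ lem (op f j) (op g j) ⟨
    op f j - op g j ∎
    where
    lem : ∀ a b → a - b ≡ a + (- 1ℚ) * b
    lem = solve-∀ ℚ-ring

  op-∑ʷ : ∀ {k} (f : Word k → Seq) j → op (λ i → ∑ʷ (λ x → f x i)) j ≡ ∑ʷ (λ x → op (f x) j)
  op-∑ʷ {zero}  f j = refl
  op-∑ʷ {suc k} f j = trans (op-+ (λ i → ∑ʷ (λ x → f (0ℙ ∷ x) i)) (λ i → ∑ʷ (λ x → f (1ℙ ∷ x) i)) j)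
    (cong₂ _+_ (op-∑ʷ (f ∘ (0ℙ ∷_)) j) (op-∑ʷ (f ∘ (1ℙ ∷_)) j))

open IsLinear public

id-linear : IsLinear id
id-linear = record { op-cong = id ; op-+ = λ _ _ _ → refl ; op-* = λ _ _ _ → refl }

shift-linear : IsLinear shift
shift-linear = record
  { op-cong = λ { e zero → refl ; e (suc j) → e j }
  ; op-+    = λ { f g zero → refl ; f g (suc j) → refl }
  ; op-*    = λ { q f zero → sym (ℚ.*-zeroʳ q) ; q f (suc j) → refl }
  }

neg-linear : IsLinear (λ f j → - f j)
neg-linear = record
  { op-cong = λ e j → cong -_ (e j)
  ; op-+    = λ f g j → ℚ.neg-distrib-+ (f j) (g j)
  ; op-*    = λ q f j → ℚ.neg-distribʳ-* q (f j)
  }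

scale-linear : ∀ q → IsLinear (λ f i → q * f i)
scale-linear q = record
  { op-cong = λ e i → cong (q *_) (e i)
  ; op-+    = λ f g i → ℚ.*-distribˡ-+ q (f i) (g i)
  ; op-*    = λ r f i → lem q r (f i)
  }
  where
  lem : ∀ q r a → q * (r * a) ≡ r * (q * a)
  lem = solve-∀ ℚ-ring

∘-linear : ∀ {op op′} → IsLinear op → IsLinear op′ → IsLinear (op ∘ op′)
∘-linear {op} {op′} l l′ = record
  { op-cong = λ e → op-cong l (op-cong l′ e)
  ; op-+    = λ f g j → trans (op-cong l (op-+ l′ f g) j) (op-+ l (op′ f) (op′ g) j)
  ; op-*    = λ q f j → trans (op-cong l (op-* l′ q f) j) (op-* l q (op′ f) j)
  }

⊞-linear : ∀ {op op′} → IsLinear op → IsLinear op′ → IsLinear (λ f j → op f j + op′ f j)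
⊞-linear {op} {op′} l l′ = record
  { op-cong = λ e j → cong₂ _+_ (op-cong l e j) (op-cong l′ e j)
  ; op-+    = λ f g j → trans (cong₂ _+_ (op-+ l f g j) (op-+ l′ f g j)) (lem (op f j) (op g j) (op′ f j) (op′ g j))
  ; op-*    = λ q f j → trans (cong₂ _+_ (op-* l q f j) (op-* l′ q f j)) (sym (ℚ.*-distribˡ-+ q (op f j) (op′ f j)))
  }
  where
  lem : ∀ a b c d → (a + b) + (c + d) ≡ (a + c) + (b + d)
  lem = solve-∀ ℚ-ring

⊟-linear : ∀ {op op′} → IsLinear op → IsLinear op′ → IsLinear (λ f j → op f j - op′ f j)
⊟-linear {op} {op′} l l′ = record
  { op-cong = λ e j → cong₂ _-_ (op-cong l e j) (op-cong l′ e j)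
  ; op-+    = λ f g j → trans (cong₂ _-_ (op-+ l f g j) (op-+ l′ f g j)) (lem (op f j) (op g j) (op′ f j) (op′ g j))
  ; op-*    = λ q f j → trans (cong₂ _-_ (op-* l q f j) (op-* l′ q f j)) (lem′ q (op f j) (op′ f j))
  }
  where
  lem : ∀ a b c d → (a + b) - (c + d) ≡ (a - c) + (b - d)
  lem = solve-∀ ℚ-ring
  lem′ : ∀ q a b → q * a - q * b ≡ q * (a - b)
  lem′ = solve-∀ ℚ-ring

[1+z] [1-z] [1-z²] : Seq → Seq
[1+z] f j  = f j + shift f j
[1-z] f j  = f j - shift f j
[1-z²] f j = f j - shift (shift f) j

[1+z]-linear : IsLinear [1+z]
[1+z]-linear = ⊞-linear id-linear shift-linear

[1-z]-linear : IsLinear [1-z]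
[1-z]-linear = ⊟-linear id-linear shift-linear

[1-z²]-linear : IsLinear [1-z²]
[1-z²]-linear = ⊟-linear id-linear (∘-linear shift-linear shift-linear)

infixl 10 _^_·_
_^_·_ : (Seq → Seq) → ℕ → Seq → Seq
op ^ m · f = fold f op m

^-linear : ∀ {op} → IsLinear op → ∀ m → IsLinear (op ^ m ·_)
^-linear l zero    = id-linear
^-linear l (suc m) = ∘-linear l (^-linear l m)

^-comm : ∀ {op} (op′ : Seq → Seq) → IsLinear op → (∀ (f : Seq) → op′ (op f) ≗ op (op′ f)) → ∀ m (f : Seq) → op′ (op ^ m · f) ≗ op ^ m · op′ f
^-comm op′ l c zero    f j = refl
^-comm {op} op′ l c (suc m) f j = trans (c (op ^ m · f) j) (op-cong l (^-comm op′ l c m f) j)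

shift-[1+z] : ∀ f → shift ([1+z] f) ≗ [1+z] (shift f)
shift-[1+z] f zero    = refl
shift-[1+z] f (suc j) = refl

shift-[1-z] : ∀ f → shift ([1-z] f) ≗ [1-z] (shift f)
shift-[1-z] f zero    = refl
shift-[1-z] f (suc j) = refl

shift-[1-z²] : ∀ f → shift ([1-z²] f) ≗ [1-z²] (shift f)
shift-[1-z²] f zero    = refl
shift-[1-z²] f (suc j) = refl

[1+z][1-z] : ∀ f → [1+z] ([1-z] f) ≗ [1-z²] f
[1+z][1-z] f j = begin
  (f j - shift f j) + shift ([1-z] f) j               ≡⟨ cong (f j - shift f j +_) (shift-[1-z] f j) ⟩
  (f j - shift f j) + (shift f j - shift (shift f) j) ≡⟨ lem (f j) (shift f j) (shift (shift f) j) ⟩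
  f j - shift (shift f) j ∎
  where
  lem : ∀ a b c → (a - b) + (b - c) ≡ a - c
  lem = solve-∀ ℚ-ring

[1-z][1+z] : ∀ f → [1-z] ([1+z] f) ≗ [1-z²] f
[1-z][1+z] f j = begin
  (f j + shift f j) - shift ([1+z] f) j               ≡⟨ cong (λ q → f j + shift f j - q) (shift-[1+z] f j) ⟩
  (f j + shift f j) - (shift f j + shift (shift f) j) ≡⟨ lem (f j) (shift f j) (shift (shift f) j) ⟩
  f j - shift (shift f) j ∎
  where
  lem : ∀ a b c → (a + b) - (b + c) ≡ a - c
  lem = solve-∀ ℚ-ring

δ₀ : Seq
δ₀ zero    = 1ℚ
δ₀ (suc _) = 0ℚ

-- (1 - z)ᵘ (1 + z)ᵛ, whose coefficients are values of Krawtchouk polynomials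
krawtchouk : ℕ → ℕ → Seq
krawtchouk u v = [1-z] ^ u · ([1+z] ^ v · δ₀)

krawtchouk-suc : ∀ u v → krawtchouk u (suc v) ≗ [1+z] (krawtchouk u v)
krawtchouk-suc u v j = sym (^-comm [1+z] [1-z]-linear (λ f i → trans ([1+z][1-z] f i) (sym ([1-z][1+z] f i))) u ([1+z] ^ v · δ₀) j)

-- Each of the `d` common factors `1 - z` is paired with a factor `1 + z`.
krawtchouk-+ : ∀ d u v → krawtchouk (d ℕ.+ u) (d ℕ.+ v) ≗ [1-z²] ^ d · krawtchouk u v
krawtchouk-+ zero    u v j = refl
krawtchouk-+ (suc d) u v j = begin
  [1-z] (krawtchouk (d ℕ.+ u) (suc (d ℕ.+ v))) j     ≡⟨ op-cong [1-z]-linear (krawtchouk-suc (d ℕ.+ u) (d ℕ.+ v)) j ⟩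
  [1-z] ([1+z] (krawtchouk (d ℕ.+ u) (d ℕ.+ v))) j   ≡⟨ [1-z][1+z] (krawtchouk (d ℕ.+ u) (d ℕ.+ v)) j ⟩
  [1-z²] (krawtchouk (d ℕ.+ u) (d ℕ.+ v)) j          ≡⟨ op-cong [1-z²]-linear (krawtchouk-+ d u v) j ⟩
  [1-z²] ([1-z²] ^ d · krawtchouk u v) j ∎

monomial : ℕ → Seq
monomial m = shift ^ m · δ₀

-- The sum factors over the coordinates: one outside the support of `c` contributes `1 + z`, one
-- inside contributes `1 - z` with the sign of the corresponding entry of `y`.
∑ʷ-χ-monomial : ∀ {n} (c y : Word n) j →
  ∑ʷ (λ x → χ c x * monomial (wt (x ⊕ y)) j) ≡ χ c y * krawtchouk (wt c) (n ∸ wt c) j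
∑ʷ-χ-monomial []       []       j = refl
∑ʷ-χ-monomial {suc n} (0ℙ ∷ c) (y ∷ ys) j = begin
  ∑ʷ (λ x → χ c x * monomial (wt (y ∷ (x ⊕ ys))) j) + ∑ʷ (λ x → χ c x * monomial (wt (y ℙ.⁻¹ ∷ (x ⊕ ys))) j)
    ≡⟨ split y ⟩
  ∑ʷ (λ x → χ c x * monomial (wt (x ⊕ ys)) j) + ∑ʷ (λ x → χ c x * shift (monomial (wt (x ⊕ ys))) j)
    ≡⟨ cong (∑ʷ (λ x → χ c x * monomial (wt (x ⊕ ys)) j) +_) (shifted j) ⟩
  ∑ʷ (λ x → χ c x * monomial (wt (x ⊕ ys)) j) + shift (λ i → ∑ʷ (λ x → χ c x * monomial (wt (x ⊕ ys)) i)) j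
    ≡⟨ op-cong [1+z]-linear (∑ʷ-χ-monomial c ys) j ⟩
  [1+z] (λ i → χ c ys * krawtchouk (wt c) (n ∸ wt c) i) j
    ≡⟨ op-* [1+z]-linear (χ c ys) (krawtchouk (wt c) (n ∸ wt c)) j ⟩
  χ c ys * [1+z] (krawtchouk (wt c) (n ∸ wt c)) j
    ≡⟨ cong (χ c ys *_) (krawtchouk-suc (wt c) (n ∸ wt c) j) ⟨
  χ c ys * krawtchouk (wt c) (suc (n ∸ wt c)) j
    ≡⟨ cong (λ v → χ c ys * krawtchouk (wt c) v j) (ℕ.+-∸-assoc 1 (wt≤n c)) ⟨
  χ c ys * krawtchouk (wt c) (suc n ∸ wt c) j ∎
  where
  shifted : ∀ j → ∑ʷ (λ x → χ c x * shift (monomial (wt (x ⊕ ys))) j) ≡ shift (λ i → ∑ʷ (λ x → χ c x * monomial (wt (x ⊕ ys)) i)) j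
  shifted zero    = ∑ʷ-zero (λ x → ℚ.*-zeroʳ (χ c x))
  shifted (suc j) = refl
  split : ∀ y → ∑ʷ (λ x → χ c x * monomial (wt (y ∷ (x ⊕ ys))) j) + ∑ʷ (λ x → χ c x * monomial (wt (y ℙ.⁻¹ ∷ (x ⊕ ys))) j)
    ≡ ∑ʷ (λ x → χ c x * monomial (wt (x ⊕ ys)) j) + ∑ʷ (λ x → χ c x * shift (monomial (wt (x ⊕ ys))) j)
  split 0ℙ = refl
  split 1ℙ = ℚ.+-comm (∑ʷ (λ x → χ c x * shift (monomial (wt (x ⊕ ys))) j)) (∑ʷ (λ x → χ c x * monomial (wt (x ⊕ ys)) j))
∑ʷ-χ-monomial {suc n} (1ℙ ∷ c) (y ∷ ys) j = begin
  ∑ʷ (λ x → χ c x * monomial (wt (y ∷ (x ⊕ ys))) j) + ∑ʷ (λ x → sgn (⟨ c , x ⟩ ℙ.⁻¹) * monomial (wt (y ℙ.⁻¹ ∷ (x ⊕ ys))) j)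
    ≡⟨ cong (∑ʷ (λ x → χ c x * monomial (wt (y ∷ (x ⊕ ys))) j) +_) (trans (∑ʷ-cong (λ x → trans (cong (_* monomial (wt (y ℙ.⁻¹ ∷ (x ⊕ ys))) j) (sgn-⁻¹ ⟨ c , x ⟩))
         (neg (χ c x) (monomial (wt (y ℙ.⁻¹ ∷ (x ⊕ ys))) j)))) (∑ʷ-*ˡ (- 1ℚ) (λ x → χ c x * monomial (wt (y ℙ.⁻¹ ∷ (x ⊕ ys))) j))) ⟩
  ∑ʷ (λ x → χ c x * monomial (wt (y ∷ (x ⊕ ys))) j) + (- 1ℚ) * ∑ʷ (λ x → χ c x * monomial (wt (y ℙ.⁻¹ ∷ (x ⊕ ys))) j)
    ≡⟨ split y ⟩
  sgn y * (∑ʷ (λ x → χ c x * monomial (wt (x ⊕ ys)) j) - ∑ʷ (λ x → χ c x * shift (monomial (wt (x ⊕ ys))) j))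
    ≡⟨ cong (λ q → sgn y * (∑ʷ (λ x → χ c x * monomial (wt (x ⊕ ys)) j) - q)) (shifted j) ⟩
  sgn y * [1-z] (λ i → ∑ʷ (λ x → χ c x * monomial (wt (x ⊕ ys)) i)) j
    ≡⟨ cong (sgn y *_) (op-cong [1-z]-linear (∑ʷ-χ-monomial c ys) j) ⟩
  sgn y * [1-z] (λ i → χ c ys * krawtchouk (wt c) (n ∸ wt c) i) j
    ≡⟨ cong (sgn y *_) (op-* [1-z]-linear (χ c ys) (krawtchouk (wt c) (n ∸ wt c)) j) ⟩
  sgn y * (χ c ys * [1-z] (krawtchouk (wt c) (n ∸ wt c)) j)
    ≡⟨ ℚ.*-assoc (sgn y) (χ c ys) ([1-z] (krawtchouk (wt c) (n ∸ wt c)) j) ⟨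
  sgn y * χ c ys * [1-z] (krawtchouk (wt c) (n ∸ wt c)) j
    ≡⟨ cong (_* [1-z] (krawtchouk (wt c) (n ∸ wt c)) j) (sgn-* y) ⟨
  sgn (y ℙ.+ ⟨ c , ys ⟩) * krawtchouk (suc (wt c)) (n ∸ wt c) j ∎
  where
  neg : ∀ a b → - a * b ≡ (- 1ℚ) * (a * b)
  neg = solve-∀ ℚ-ring
  sgn-* : ∀ y → sgn (y ℙ.+ ⟨ c , ys ⟩) ≡ sgn y * χ c ys
  sgn-* 0ℙ = sym (ℚ.*-identityˡ (χ c ys))
  sgn-* 1ℙ = trans (sgn-⁻¹ ⟨ c , ys ⟩) (neg1 (χ c ys))
    where
    neg1 : ∀ a → - a ≡ (- 1ℚ) * a
    neg1 = solve-∀ ℚ-ring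
  shifted : ∀ j → ∑ʷ (λ x → χ c x * shift (monomial (wt (x ⊕ ys))) j) ≡ shift (λ i → ∑ʷ (λ x → χ c x * monomial (wt (x ⊕ ys)) i)) j
  shifted zero    = ∑ʷ-zero (λ x → ℚ.*-zeroʳ (χ c x))
  shifted (suc j) = refl
  lem₀ : ∀ a b → a + (- 1ℚ) * b ≡ 1ℚ * (a - b)
  lem₀ = solve-∀ ℚ-ring
  lem₁ : ∀ a b → b + (- 1ℚ) * a ≡ (- 1ℚ) * (a - b)
  lem₁ = solve-∀ ℚ-ring
  split : ∀ y → ∑ʷ (λ x → χ c x * monomial (wt (y ∷ (x ⊕ ys))) j) + (- 1ℚ) * ∑ʷ (λ x → χ c x * monomial (wt (y ℙ.⁻¹ ∷ (x ⊕ ys))) j)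
    ≡ sgn y * (∑ʷ (λ x → χ c x * monomial (wt (x ⊕ ys)) j) - ∑ʷ (λ x → χ c x * shift (monomial (wt (x ⊕ ys))) j))
  split 0ℙ = lem₀ (∑ʷ (λ x → χ c x * monomial (wt (x ⊕ ys)) j)) (∑ʷ (λ x → χ c x * shift (monomial (wt (x ⊕ ys))) j))
  split 1ℙ = lem₁ (∑ʷ (λ x → χ c x * monomial (wt (x ⊕ ys)) j)) (∑ʷ (λ x → χ c x * shift (monomial (wt (x ⊕ ys))) j))

-- Inclusion-exclusion over the subsets of a set

initial : ∀ n → ℕ → Word n
initial zero    w       = []
initial (suc n) zero    = 0ℙ ∷ initial n 0
initial (suc n) (suc w) = 1ℙ ∷ initial n w

wt-initial : ∀ {n w} → w ℕ.≤ n → wt (initial n w) ≡ w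
wt-initial {zero}          ℕ.z≤n       = refl
wt-initial {suc n} {zero}  ℕ.z≤n       = wt-initial {n} ℕ.z≤n
wt-initial {suc n} {suc w} (ℕ.s≤s w≤n) = cong suc (wt-initial w≤n)

-- The sum of (-op)^|T ∖ S| (ψ S) over the subsets S of T.
alt : (Seq → Seq) → ∀ {n} → Word n → (Word n → Seq) → Seq
alt op []       ψ = ψ []
alt op (0ℙ ∷ T) ψ = alt op T (ψ ∘ (0ℙ ∷_))
alt op (1ℙ ∷ T) ψ = λ j → alt op T (ψ ∘ (1ℙ ∷_)) j - op (alt op T (ψ ∘ (0ℙ ∷_))) j

module _ {op : Seq → Seq} (l : IsLinear op) where

  alt-cong : ∀ {n} (T : Word n) {ψ ψ′} → (∀ S → wt S ℕ.≤ wt T → ψ S ≗ ψ′ S) → alt op T ψ ≗ alt op T ψ′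
  alt-cong []       e j = e [] ℕ.≤-refl j
  alt-cong (0ℙ ∷ T) e j = alt-cong T (e ∘ (0ℙ ∷_)) j
  alt-cong (1ℙ ∷ T) e j = cong₂ _-_ (alt-cong T (λ S → e (1ℙ ∷ S) ∘ ℕ.s≤s) j)
    (op-cong l (alt-cong T (λ S → e (0ℙ ∷ S) ∘ ℕ.m≤n⇒m≤1+n)) j)

  alt-∑ʷ : ∀ {n k} (T : Word n) (f : Word k → Word n → Seq) j →
    alt op T (λ S i → ∑ʷ (λ x → f x S i)) j ≡ ∑ʷ (λ x → alt op T (f x) j)
  alt-∑ʷ []       f j = refl
  alt-∑ʷ (0ℙ ∷ T) f j = alt-∑ʷ T (λ x → f x ∘ (0ℙ ∷_)) j
  alt-∑ʷ (1ℙ ∷ T) f j = trans (cong₂ _-_ (alt-∑ʷ T (λ x → f x ∘ (1ℙ ∷_)) j)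
    (trans (op-cong l (alt-∑ʷ T (λ x → f x ∘ (0ℙ ∷_))) j) (op-∑ʷ l (λ x → alt op T (f x ∘ (0ℙ ∷_))) j)))
    (sym (∑ʷ-- (λ x → alt op T (f x ∘ (1ℙ ∷_)) j) (λ x → op (alt op T (f x ∘ (0ℙ ∷_))) j)))

  alt-linear : ∀ {n} (T : Word n) {op′} → IsLinear op′ → (∀ f → op′ (op f) ≗ op (op′ f)) →
    ∀ ψ → alt op T (op′ ∘ ψ) ≗ op′ (alt op T ψ)
  alt-linear []       l′ c ψ j = refl
  alt-linear (0ℙ ∷ T) l′ c ψ j = alt-linear T l′ c (ψ ∘ (0ℙ ∷_)) j
  alt-linear (1ℙ ∷ T) {op′} l′ c ψ j = trans
    (cong₂ _-_ (alt-linear T l′ c (ψ ∘ (1ℙ ∷_)) j)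
      (trans (op-cong l (alt-linear T l′ c (ψ ∘ (0ℙ ∷_))) j) (sym (c (alt op T (ψ ∘ (0ℙ ∷_))) j))))
    (sym (op-- l′ (alt op T (ψ ∘ (1ℙ ∷_))) (op (alt op T (ψ ∘ (0ℙ ∷_)))) j))

  -- The term of the full set `T` has coefficient 1 and is the only one at weight `wt T`; all others
  -- are equal for `ψ` and `ψ′`.
  alt-top : ∀ {n} (T : Word n) {ψ ψ′} → (∀ S → wt S ℕ.< wt T → ψ S ≗ ψ′ S) → ∀ j →
    alt op T ψ j - alt op T ψ′ j ≡ ψ T j - ψ′ T j
  alt-top []       e j = refl
  alt-top (0ℙ ∷ T) e j = alt-top T (e ∘ (0ℙ ∷_)) j
  alt-top (1ℙ ∷ T) {ψ} {ψ′} e j = trans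
    (lem (alt op T (ψ ∘ (1ℙ ∷_)) j) (alt op T (ψ′ ∘ (1ℙ ∷_)) j)
         (op-cong l (alt-cong T (λ S → e (0ℙ ∷ S) ∘ ℕ.s≤s)) j))
    (alt-top T (λ S → e (1ℙ ∷ S) ∘ ℕ.s≤s) j)
    where
    ring : ∀ a b c → (a - c) - (b - c) ≡ a - b
    ring = solve-∀ ℚ-ring
    lem : ∀ a b {c c′} → c ≡ c′ → (a - c) - (b - c′) ≡ a - b
    lem a b {c} refl = ring a b c

  private
    radial : ℕ → (ℕ → Seq) → Seq
    radial zero    θ = θ 0
    radial (suc w) θ = λ j → radial w (θ ∘ suc) j - op (radial w θ) j

    alt-wt : ∀ {n} (T : Word n) θ → alt op T (θ ∘ wt) ≗ radial (wt T) θ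
    alt-wt []       θ j = refl
    alt-wt (0ℙ ∷ T) θ j = alt-wt T θ j
    alt-wt (1ℙ ∷ T) θ j = cong₂ _-_ (alt-wt T (θ ∘ suc) j) (op-cong l (alt-wt T θ) j)

  -- A function of the weight has the same alternating sum over `T` and `T′`. Comparing `ψ` with the
  -- function `θ ∘ wt` that agrees with it below `wt T` leaves only the two top terms, in which
  -- `θ (wt T)` cancels.
  alt-radial : ∀ {n} (T T′ : Word n) → wt T ≡ wt T′ → {ψ : Word n → Seq} →
    (∀ S S′ → wt S ≡ wt S′ → wt S ℕ.< wt T → ψ S ≗ ψ S′) → ∀ j →
    alt op T ψ j - alt op T′ ψ j ≡ ψ T j - ψ T′ j
  alt-radial {n} T T′ wt≡ {ψ} e j = begin
    alt op T ψ j - alt op T′ ψ j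
      ≡⟨ lem (alt op T ψ j) (alt op T′ ψ j) A (ψ T j) (ψ T′ j) (θ (wt T) j)
           (alt-top T {ψ} {θ ∘ wt} (below T ℕ.≤-refl) j)
           (trans (cong (λ q → alt op T′ ψ j - q) A≡)
             (trans (alt-top T′ {ψ} {θ ∘ wt} (below T′ (ℕ.≤-reflexive (sym wt≡))) j) (cong (λ w → ψ T′ j - θ w j) (sym wt≡)))) ⟩
    ψ T j - ψ T′ j ∎
    where
    θ : ℕ → Seq
    -- One representative of each weight is enough to read off the radial part of `ψ`.
    θ w = ψ (initial n w)
    A = alt op T (θ ∘ wt) j
    A≡ : A ≡ alt op T′ (θ ∘ wt) j
    A≡ = trans (alt-wt T θ j) (trans (cong (λ w → radial w θ j) wt≡) (sym (alt-wt T′ θ j)))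
    below : ∀ (U : Word n) → wt U ℕ.≤ wt T → ∀ S → wt S ℕ.< wt U → ψ S ≗ θ (wt S)
    below U U≤ S S< = e S (initial n (wt S)) (sym (wt-initial (wt≤n S))) (ℕ.<-≤-trans S< U≤)
    ring₁ : ∀ x y a → x - y ≡ (x - a) - (y - a)
    ring₁ = solve-∀ ℚ-ring
    ring₂ : ∀ p q t → (p - t) - (q - t) ≡ p - q
    ring₂ = solve-∀ ℚ-ring
    lem : ∀ x y a p q t → x - a ≡ p - t → y - a ≡ q - t → x - y ≡ p - q
    lem x y a p q t e₁ e₂ = trans (ring₁ x y a) (trans (cong₂ _-_ e₁ e₂) (ring₂ p q t))

-- z^|x ∖ T| if T ⊆ x, and 0 otherwise
cover : ∀ {n} → Word n → Word n → Seq
cover []       []       = δ₀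
cover (0ℙ ∷ T) (0ℙ ∷ x) = cover T x
cover (0ℙ ∷ T) (1ℙ ∷ x) = shift (cover T x)
cover (1ℙ ∷ T) (0ℙ ∷ x) = λ _ → 0ℚ
cover (1ℙ ∷ T) (1ℙ ∷ x) = cover T x

alt-shift : ∀ {n} (T : Word n) ψ → alt shift T (shift ∘ ψ) ≗ shift (alt shift T ψ)
alt-shift T = alt-linear shift-linear T shift-linear (λ _ _ → refl)

-- Again a product over coordinates. A point of `T` in `x` gives 1 if it is in `S` and -z·z if not,
-- together 1 - z²; a point of `T` missing from `x` gives z - z = 0; a point outside `T` keeps its
-- power of z.
alt-monomial : ∀ {n} (T x : Word n) → alt shift T (λ S → monomial (wt (x ⊕ S))) ≗ [1-z²] ^ wt T · cover T x
alt-monomial []       []       j = refl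
alt-monomial (0ℙ ∷ T) (0ℙ ∷ x) j = alt-monomial T x j
alt-monomial (0ℙ ∷ T) (1ℙ ∷ x) j = begin
  alt shift T (shift ∘ (λ S → monomial (wt (x ⊕ S)))) j ≡⟨ alt-shift T (λ S → monomial (wt (x ⊕ S))) j ⟩
  shift (alt shift T (λ S → monomial (wt (x ⊕ S)))) j   ≡⟨ op-cong shift-linear (alt-monomial T x) j ⟩
  shift ([1-z²] ^ wt T · cover T x) j                   ≡⟨ ^-comm shift [1-z²]-linear shift-[1-z²] (wt T) (cover T x) j ⟩
  ([1-z²] ^ wt T · shift (cover T x)) j ∎
alt-monomial (1ℙ ∷ T) (0ℙ ∷ x) j = trans
  (x≡y⇒x-y≡0 (alt-shift T (λ S → monomial (wt (x ⊕ S))) j))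
  (sym (op-zero (^-linear [1-z²]-linear (suc (wt T))) (λ _ → refl) j))
alt-monomial (1ℙ ∷ T) (1ℙ ∷ x) j = begin
  alt shift T (λ S → monomial (wt (x ⊕ S))) j - shift (alt shift T (shift ∘ (λ S → monomial (wt (x ⊕ S))))) j
    ≡⟨ cong (λ q → alt shift T (λ S → monomial (wt (x ⊕ S))) j - q) (op-cong shift-linear (alt-shift T (λ S → monomial (wt (x ⊕ S)))) j) ⟩
  [1-z²] (alt shift T (λ S → monomial (wt (x ⊕ S)))) j ≡⟨ op-cong [1-z²]-linear (alt-monomial T x) j ⟩
  [1-z²] ([1-z²] ^ wt T · cover T x) j ∎

-- Möbius inversion of characters

[-2]^_ : ℕ → ℚ
[-2]^ zero  = 1ℚ
[-2]^ suc w = (- (1ℚ + 1ℚ)) * [-2]^ w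

[-2]^≢0 : ∀ w → [-2]^ w ≢ 0ℚ
[-2]^≢0 zero    ()
[-2]^≢0 (suc w) = *-≢0 { - (1ℚ + 1ℚ)} (λ ()) ([-2]^≢0 w)

-- `alt` with the identity operator on constant sequences, so the index 0 is arbitrary. Its value is
-- the product over the points i of `T` of (-1)^(c_i) - 1, hence (-2)^|T| if `c` covers `T` and 0
-- otherwise.
altχ : ∀ {n} → Word n → Word n → ℚ
altχ T c = alt id T (λ S _ → χ c S) 0

altχ-diagonal : ∀ {n} (T : Word n) → altχ T T ≡ [-2]^ wt T
altχ-diagonal []       = refl
altχ-diagonal (0ℙ ∷ T) = altχ-diagonal T
altχ-diagonal (1ℙ ∷ T) = begin
  alt id T (λ S _ → sgn (⟨ T , S ⟩ ℙ.⁻¹)) 0 - altχ T T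
    ≡⟨ cong (λ q → q - altχ T T) (trans (alt-cong id-linear T (λ S _ _ → sgn-⁻¹ ⟨ T , S ⟩) 0)
         (alt-linear id-linear T neg-linear (λ _ _ → refl) (λ S _ → χ T S) 0)) ⟩
  - altχ T T - altχ T T ≡⟨ lem (altχ T T) ⟩
  (- (1ℚ + 1ℚ)) * altχ T T ≡⟨ cong ((- (1ℚ + 1ℚ)) *_) (altχ-diagonal T) ⟩
  (- (1ℚ + 1ℚ)) * [-2]^ wt T ∎
  where
  lem : ∀ a → - a - a ≡ (- (1ℚ + 1ℚ)) * a
  lem = solve-∀ ℚ-ring

-- A word no heavier than `T` covers `T` only if it equals `T`.
altχ-off-diagonal : ∀ {n} (T c : Word n) → wt c ℕ.≤ wt T → T ≢ c → altχ T c ≡ 0ℚ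
altχ-off-diagonal []       []       _    T≢c = contradiction refl T≢c
altχ-off-diagonal (0ℙ ∷ T) (0ℙ ∷ c) c≤   T≢c = altχ-off-diagonal T c c≤ (T≢c ∘ cong (0ℙ ∷_))
altχ-off-diagonal (0ℙ ∷ T) (1ℙ ∷ c) c<   T≢c = altχ-off-diagonal T c (ℕ.<⇒≤ c<) λ { refl → ℕ.1+n≰n c< }
altχ-off-diagonal (1ℙ ∷ T) (0ℙ ∷ c) c≤   T≢c = ℚ.+-inverseʳ (altχ T c)
altχ-off-diagonal (1ℙ ∷ T) (1ℙ ∷ c) (ℕ.s≤s c≤) T≢c = begin
  alt id T (λ S _ → sgn (⟨ c , S ⟩ ℙ.⁻¹)) 0 - altχ T c
    ≡⟨ cong (λ q → q - altχ T c) (trans (alt-cong id-linear T (λ S _ _ → sgn-⁻¹ ⟨ c , S ⟩) 0)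
         (alt-linear id-linear T neg-linear (λ _ _ → refl) (λ S _ → χ c S) 0)) ⟩
  - altχ T c - altχ T c ≡⟨ cong (λ q → - q - q) (altχ-off-diagonal T c c≤ (T≢c ∘ cong (1ℙ ∷_))) ⟩
  0ℚ ∎

-- Counting words and blocks

count : ∀ {n} {P : Pred (Word n) 0ℓ} → (∀ x → Dec (P x)) → ℕ
count {zero}  P? with P? []
... | yes _ = 1
... | no _  = 0
count {suc n} P? = count (P? ∘ (0ℙ ∷_)) ℕ.+ count (P? ∘ (1ℙ ∷_))

∑ʷ-⟦⟧ : ∀ {n} {P : Pred (Word n) 0ℓ} (P? : ∀ x → Dec (P x)) → ∑ʷ (λ x → ⟦ P? x ⟧) ≡ ↑ count P?
∑ʷ-⟦⟧ {zero}  P? with P? []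
... | yes _ = refl
... | no _  = refl
∑ʷ-⟦⟧ {suc n} P? = trans (cong₂ _+_ (∑ʷ-⟦⟧ (P? ∘ (0ℙ ∷_))) (∑ʷ-⟦⟧ (P? ∘ (1ℙ ∷_))))
  (sym (↑-homo-+ (count (P? ∘ (0ℙ ∷_))) (count (P? ∘ (1ℙ ∷_)))))

count-cardinality : ∀ {n} {P : Pred (Word n) 0ℓ} (P? : ∀ x → Dec (P x)) → HasCardinality P (count P?)
count-cardinality {zero} {P} P? with P? []
... | yes p = ([] ∷ []) , ([] ∷ []) , (λ { [] → mk⇔ (λ _ → p) (λ _ → here refl) }) , refl
... | no ¬p = [] , [] , (λ { [] → mk⇔ (λ ()) (λ p → contradiction p ¬p) }) , refl
count-cardinality {suc n} {P} P? with count-cardinality (P? ∘ (0ℙ ∷_)) | count-cardinality (P? ∘ (1ℙ ∷_))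
... | xs , xs! , xs⇔ , xs≡ | ys , ys! , ys⇔ , ys≡ =
  List.map (0ℙ ∷_) xs List.++ List.map (1ℙ ∷_) ys
  , ++⁺ (map⁺ ∷-injectiveʳ xs!) (map⁺ ∷-injectiveʳ ys!) disjoint
  , (λ x → mk⇔ (to x) (from x))
  , trans (length-++ (List.map (0ℙ ∷_) xs)) (cong₂ ℕ._+_ (trans (length-map (0ℙ ∷_) xs) xs≡) (trans (length-map (1ℙ ∷_) ys) ys≡))
  where
  disjoint : ∀ {x} → ¬ (x ∈ List.map (0ℙ ∷_) xs × x ∈ List.map (1ℙ ∷_) ys)
  disjoint (p , q) with ∈-map⁻ (0ℙ ∷_) p | ∈-map⁻ (1ℙ ∷_) q
  ... | _ , _ , refl | _ , _ , ()
  to : ∀ x → x ∈ List.map (0ℙ ∷_) xs List.++ List.map (1ℙ ∷_) ys → P x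
  to x m with ∈-++⁻ (List.map (0ℙ ∷_) xs) m
  ... | inj₁ p with ∈-map⁻ (0ℙ ∷_) p
  ...   | z , z∈ , refl = Equivalence.to (xs⇔ z) z∈
  to x m | inj₂ p with ∈-map⁻ (1ℙ ∷_) p
  ...   | z , z∈ , refl = Equivalence.to (ys⇔ z) z∈
  from : ∀ x → P x → x ∈ List.map (0ℙ ∷_) xs List.++ List.map (1ℙ ∷_) ys
  from (0ℙ ∷ z) p = ∈-++⁺ˡ (∈-map⁺ (0ℙ ∷_) (Equivalence.from (xs⇔ z) p))
  from (1ℙ ∷ z) p = ∈-++⁺ʳ (List.map (0ℙ ∷_) xs) (∈-map⁺ (1ℙ ∷_) (Equivalence.from (ys⇔ z) p))

∑ʷ-⟦⟧≡0⇒none : ∀ {n} {P : Pred (Word n) 0ℓ} (P? : ∀ x → Dec (P x)) → ∑ʷ (λ x → ⟦ P? x ⟧) ≡ 0ℚ → ∀ x → ¬ P x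
∑ʷ-⟦⟧≡0⇒none P? e x p with count-cardinality P?
... | [] , _ , xs⇔ , _ with Equivalence.from (xs⇔ x) p
...   | ()
∑ʷ-⟦⟧≡0⇒none P? e x p | _ ∷ _ , _ , _ , xs≡ with trans xs≡ (↑-injective {count P?} {0} (trans (sym (∑ʷ-⟦⟧ P?)) e))
... | ()

support-injective : ∀ {n} {x y : Word n} → support x ≡ support y → x ≡ y
support-injective {x = []}     {[]}     _ = refl
support-injective {x = 0ℙ ∷ x} {0ℙ ∷ y} e = cong (0ℙ ∷_) (support-injective (∷-injectiveʳ e))
support-injective {x = 1ℙ ∷ x} {1ℙ ∷ y} e = cong (1ℙ ∷_) (support-injective (∷-injectiveʳ e))

indicator : ∀ {n} → Subset n → Word n
indicator []          = []
indicator (false ∷ T) = 0ℙ ∷ indicator T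
indicator (true ∷ T)  = 1ℙ ∷ indicator T

support-indicator : ∀ {n} (T : Subset n) → support (indicator T) ≡ T
support-indicator []          = refl
support-indicator (false ∷ T) = cong (false ∷_) (support-indicator T)
support-indicator (true ∷ T)  = cong (true ∷_) (support-indicator T)

⟦×-dec⟧ : {A B : Set} (A? : Dec A) (B? : Dec B) → ⟦ A? ×-dec B? ⟧ ≡ ⟦ A? ⟧ * ⟦ B? ⟧
⟦×-dec⟧ (yes _) (yes _) = refl
⟦×-dec⟧ (yes _) (no _)  = refl
⟦×-dec⟧ (no _)  (yes _) = refl
⟦×-dec⟧ (no _)  (no _)  = refl

Covers : ∀ {n} → Word n → ℕ → Word n → Set
Covers T j x = wt x ≡ j ℕ.+ wt T × support T ⊆ support x

covers? : ∀ {n} (T : Word n) j x → Dec (Covers T j x)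
covers? T j x = (wt x ℕ.≟ j ℕ.+ wt T) ×-dec (support T ⊆? support x)

cover-⟦⟧ : ∀ {n} (T x : Word n) j → cover T x j ≡ ⟦ covers? T j x ⟧
cover-⟦⟧ []       []       zero    = sym (⟦⟧-yes (covers? [] 0 []) (refl , id))
cover-⟦⟧ []       []       (suc j) = sym (⟦⟧-no (covers? [] (suc j) []) λ ())
cover-⟦⟧ (0ℙ ∷ T) (0ℙ ∷ x) j = trans (cover-⟦⟧ T x j) (⟦⟧-cong (covers? T j x) (covers? (0ℙ ∷ T) j (0ℙ ∷ x))
  (λ (p , q) → p , out⊆ q) (λ (p , q) → p , drop-∷-⊆ q))
cover-⟦⟧ (0ℙ ∷ T) (1ℙ ∷ x) zero = sym (⟦⟧-no (covers? (0ℙ ∷ T) 0 (1ℙ ∷ x))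
  λ (p , q) → ℕ.1+n≰n (ℕ.≤-trans (ℕ.≤-reflexive p) (p⊆q⇒∣p∣≤∣q∣ (drop-∷-⊆ q))))
cover-⟦⟧ (0ℙ ∷ T) (1ℙ ∷ x) (suc j) = trans (cover-⟦⟧ T x j) (⟦⟧-cong (covers? T j x) (covers? (0ℙ ∷ T) (suc j) (1ℙ ∷ x))
  (λ (p , q) → cong suc p , out⊆ q) (λ (p , q) → ℕ.suc-injective p , drop-∷-⊆ q))
cover-⟦⟧ (1ℙ ∷ T) (0ℙ ∷ x) j = sym (⟦⟧-no (covers? (1ℙ ∷ T) j (0ℙ ∷ x)) λ (p , q) → in⊈out q)
  where
  in⊈out : ¬ (support (1ℙ ∷ T) ⊆ support (0ℙ ∷ x))
  in⊈out q with q here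
  ... | ()
cover-⟦⟧ (1ℙ ∷ T) (1ℙ ∷ x) j = trans (cover-⟦⟧ T x j) (⟦⟧-cong (covers? T j x) (covers? (1ℙ ∷ T) j (1ℙ ∷ x))
  (λ (p , q) → trans (cong suc p) (sym (ℕ.+-suc j (wt T))) , in⊆in q)
  (λ (p , q) → ℕ.suc-injective (trans p (ℕ.+-suc j (wt T))) , drop-∷-⊆ q))

support-cardinality : ∀ {n m w} {D : Pred (Word n) 0ℓ} {T : Subset n} →
  HasCardinality (λ x → D x × wt x ≡ w × T ⊆ support x) m →
  HasCardinality (λ B → supportDesign D w B × T ⊆ B) m
support-cardinality {D = D} {T} (xs , xs! , xs⇔ , xs≡) =
  List.map support xs , map⁺ support-injective xs! , (λ B → mk⇔ to from) , trans (length-map support xs) xs≡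
  where
  to : ∀ {B} → B ∈ List.map support xs → _
  to m with ∈-map⁻ support m
  ... | x , x∈ , refl with Equivalence.to (xs⇔ x) x∈
  ...   | d , w≡ , T⊆ = (x , (d , w≡) , refl) , λ {i} → T⊆ {i}
  from : ∀ {B} → supportDesign D _ B × T ⊆ B → B ∈ List.map support xs
  from ((x , (d , w≡) , refl) , T⊆) = ∈-map⁺ support (Equivalence.from (xs⇔ x) (d , w≡ , λ {i} → T⊆ {i}))

-- MacWilliams' identity and the number of blocks through a set

module Counting {n k} (C : Pred (Word n) 0ℓ) (C-sub : IsSubspace C) (b : Fin k → Word n) (b-basis : IsBasis C b) where

  open Code C C-sub b b-basis
  private
    cw : Word k → Word n
    cw a = linearCombination a b

  -- Not a Hamming weight: by `∑χ` it is `2^ k` times the indicator of the dual. Kept as a character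
  -- sum, it reduces `macWilliams` to an exchange of two sums.
  weight : Word n → ℚ
  weight x = ∑ʷ (λ a → χ (cw a) x)

  -- Up to `2^ k`, the enumerator of the dual words covering `T`, graded by the number of points
  -- outside `T`.
  X : Word n → Seq
  X T j = ∑ʷ (λ x → weight x * cover T x j)

  -- Up to `2^ k`, the weight enumerator of the coset of the dual through `S`.
  B : Word n → Seq
  B S j = ∑ʷ (λ x → weight x * monomial (wt (x ⊕ S)) j)

  macWilliams : ∀ S j → B S j ≡ F S (λ u → krawtchouk u (n ∸ u) j)
  macWilliams S j = begin
    ∑ʷ (λ x → weight x * monomial (wt (x ⊕ S)) j)
      ≡⟨ ∑ʷ-cong (λ x → trans (ℚ.*-comm (weight x) (monomial (wt (x ⊕ S)) j))
           (trans (sym (∑ʷ-*ˡ (monomial (wt (x ⊕ S)) j) (λ a → χ (cw a) x)))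
             (∑ʷ-cong (λ a → ℚ.*-comm (monomial (wt (x ⊕ S)) j) (χ (cw a) x))))) ⟩
    ∑ʷ (λ x → ∑ʷ (λ a → χ (cw a) x * monomial (wt (x ⊕ S)) j))
      ≡⟨ ∑ʷ-comm (λ x a → χ (cw a) x * monomial (wt (x ⊕ S)) j) ⟩
    ∑ʷ (λ a → ∑ʷ (λ x → χ (cw a) x * monomial (wt (x ⊕ S)) j))
      ≡⟨ ∑ʷ-cong (λ a → ∑ʷ-χ-monomial (cw a) S j) ⟩
    F S (λ u → krawtchouk u (n ∸ u) j) ∎

  X-alt : ∀ T → [1-z²] ^ wt T · X T ≗ alt shift T B
  X-alt T j = begin
    ([1-z²] ^ wt T · X T) j
      ≡⟨ op-∑ʷ E (λ x i → weight x * cover T x i) j ⟩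
    ∑ʷ (λ x → ([1-z²] ^ wt T · (λ i → weight x * cover T x i)) j)
      ≡⟨ ∑ʷ-cong (λ x → begin
        ([1-z²] ^ wt T · (λ i → weight x * cover T x i)) j  ≡⟨ op-* E (weight x) (cover T x) j ⟩
        weight x * ([1-z²] ^ wt T · cover T x) j            ≡⟨ cong (weight x *_) (alt-monomial T x j) ⟨
        weight x * alt shift T (λ S → monomial (wt (x ⊕ S))) j
          ≡⟨ alt-linear shift-linear T (scale-linear (weight x)) (λ f i → sym (op-* shift-linear (weight x) f i)) (λ S → monomial (wt (x ⊕ S))) j ⟨
        alt shift T (λ S i → weight x * monomial (wt (x ⊕ S)) i) j ∎) ⟩
    ∑ʷ (λ x → alt shift T (λ S i → weight x * monomial (wt (x ⊕ S)) i) j)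
      ≡⟨ alt-∑ʷ shift-linear T (λ x S i → weight x * monomial (wt (x ⊕ S)) i) j ⟨
    alt shift T B j ∎
    where
    E = ^-linear [1-z²]-linear (wt T)

  block? : ∀ T j x → Dec ((C ⊥) x × Covers T j x)
  block? T j x = ⊥? x ×-dec covers? T j x

  X-count : ∀ T j → X T j ≡ 2^ k * ↑ count (block? T j)
  X-count T j = begin
    ∑ʷ (λ x → weight x * cover T x j)
      ≡⟨ ∑ʷ-cong (λ x → trans (cong₂ _*_ (∑χ x) (cover-⟦⟧ T x j))
           (trans (ℚ.*-assoc (2^ k) ⟦ ⊥? x ⟧ ⟦ covers? T j x ⟧) (cong (2^ k *_) (sym (⟦×-dec⟧ (⊥? x) (covers? T j x)))))) ⟩
    ∑ʷ (λ x → 2^ k * ⟦ block? T j x ⟧) ≡⟨ ∑ʷ-*ˡ (2^ k) (λ x → ⟦ block? T j x ⟧) ⟩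
    2^ k * ∑ʷ (λ x → ⟦ block? T j x ⟧) ≡⟨ cong (2^ k *_) (∑ʷ-⟦⟧ (block? T j)) ⟩
    2^ k * ↑ count (block? T j) ∎

  design : ∀ r j → (∀ T T′ → wt T ≡ r → wt T′ ≡ r → X T j ≡ X T′ j) → IsDesign r (supportDesign (C ⊥) (j ℕ.+ r))
  design r j X-const = (j ℕ.+ r) , (λ { _ (_ , (_ , w≡) , refl) → w≡ }) , count (block? T₀ j) , λ T ∣T∣≡r →
    support-cardinality (subst (λ U → HasCardinality (λ x → (C ⊥) x × wt x ≡ j ℕ.+ r × U ⊆ support x) (count (block? T₀ j)))
      (support-indicator T) (card (indicator T) (trans (cong ∣_∣ (support-indicator T)) ∣T∣≡r)))
    where
    -- For `r > n` this word does not have weight `r`, but then there is no set of size `r` to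
    -- compare with either.
    T₀ = initial n r
    card : ∀ T → wt T ≡ r → HasCardinality (λ x → (C ⊥) x × wt x ≡ j ℕ.+ r × support T ⊆ support x) (count (block? T₀ j))
    card T refl = subst (HasCardinality _) (↑-injective (ℚ-cancel (trans (sym (X-count T j))
      (trans (X-const T T₀ refl (wt-initial (wt≤n T))) (X-count T₀ j))))) (count-cardinality (block? T j))
      where
      ℚ-cancel : ∀ {p q} → 2^ k * p ≡ 2^ k * q → p ≡ q
      ℚ-cancel {p} {q} e = x-y≡0⇒x≡y (x*y≡0⇒y≡0 (2^≢0 k) (trans (lem (2^ k) p q) (x≡y⇒x-y≡0 e)))
        where
        lem : ∀ a p q → a * (p - q) ≡ a * p - a * q
        lem = solve-∀ ℚ-ring

1/suc-inverse : ∀ k → (ℤ.+ 1 / suc k) * (1ℚ + ↑ k) ≡ 1ℚ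
1/suc-inverse k = trans (cong ((ℤ.+ 1 / suc k) *_) (sym (↑-suc k)))
  (ℚ.toℚᵘ-injective (ℚᵘ.≃-trans (ℚ.toℚᵘ-homo-* (ℤ.+ 1 / suc k) (↑ suc k))
    (ℚᵘ.≃-trans (ℚᵘ.*-cong (ℚ.toℚᵘ-fromℚᵘ (mkℚᵘ (ℤ.+ 1) k)) (ℚ.toℚᵘ-fromℚᵘ (mkℚᵘ (ℤ.+ suc k) 0)))
      (*≡* (trans (ℤ.*-identityʳ (ℤ.+ 1 ℤ.* ℤ.+ suc k)) (cong (ℤ._*_ (ℤ.+ 1)) (sym (cong (ℤ.+_ ∘ suc) (ℕ.*-identityʳ k)))))))))

↑-/2 : ∀ m → ℤ.+ (m ℕ.+ m) / 2 ≡ ↑ m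
↑-/2 m = ℚ.fromℚᵘ-cong {mkℚᵘ (ℤ.+ (m ℕ.+ m)) 1} {mkℚᵘ (ℤ.+ m) 0} (*≡* (begin
  ℤ.+ (m ℕ.+ m) ℤ.* ℤ.+ 1 ≡⟨ ℤ.*-identityʳ (ℤ.+ (m ℕ.+ m)) ⟩
  ℤ.+ (m ℕ.+ m)           ≡⟨ cong ℤ.+_ (cong (m ℕ.+_) (ℕ.+-identityʳ m)) ⟨
  ℤ.+ (2 ℕ.* m)           ≡⟨ cong ℤ.+_ (ℕ.*-comm 2 m) ⟩
  ℤ.+ (m ℕ.* 2)           ≡⟨ ℤ.pos-* m 2 ⟩
  ℤ.+ m ℤ.* ℤ.+ 2 ∎))

-- Binomial series

binom-absorb : ∀ x k → binom (1ℚ + x) (suc k) ≡ (1ℚ + x) * binom x k * (ℤ.+ 1 / suc k)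
binom-absorb x zero    = lem x (ℤ.+ 1 / 1)
  where
  lem : ∀ x i → 1ℚ * ((1ℚ + x) - 0ℚ) * i ≡ (1ℚ + x) * 1ℚ * i
  lem = solve-∀ ℚ-ring
binom-absorb x (suc k) = begin
  binom (1ℚ + x) (suc k) * ((1ℚ + x) - ↑ suc k) * i′
    ≡⟨ cong₂ (λ p q → p * ((1ℚ + x) - q) * i′) (binom-absorb x k) (↑-suc k) ⟩
  (1ℚ + x) * binom x k * i * ((1ℚ + x) - (1ℚ + ↑ k)) * i′ ≡⟨ lem x (binom x k) i (↑ k) i′ ⟩
  (1ℚ + x) * binom x (suc k) * i′ ∎
  where
  i  = ℤ.+ 1 / suc k
  i′ = ℤ.+ 1 / suc (suc k)
  lem : ∀ x b i k i′ → (1ℚ + x) * b * i * ((1ℚ + x) - (1ℚ + k)) * i′ ≡ (1ℚ + x) * (b * (x - k) * i) * i′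
  lem = solve-∀ ℚ-ring

-- Absorption, followed by the split 1 + x = (x - k) + (1 + k). It holds for every rational `x`,
-- hence also for a negative upper entry.
pascal : ∀ x k → binom (1ℚ + x) (suc k) ≡ binom x (suc k) + binom x k
pascal x k = begin
  binom (1ℚ + x) (suc k)           ≡⟨ binom-absorb x k ⟩
  (1ℚ + x) * b * i                 ≡⟨ lem x b i (↑ k) ⟩
  b * (x - ↑ k) * i + b * (i * (1ℚ + ↑ k)) ≡⟨ cong (λ q → b * (x - ↑ k) * i + b * q) (1/suc-inverse k) ⟩
  b * (x - ↑ k) * i + b * 1ℚ       ≡⟨ cong (b * (x - ↑ k) * i +_) (ℚ.*-identityʳ b) ⟩
  binom x (suc k) + binom x k ∎
  where
  b = binom x k
  i = ℤ.+ 1 / suc k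
  lem : ∀ x b i k → (1ℚ + x) * b * i ≡ b * (x - k) * i + b * (i * (1ℚ + k))
  lem = solve-∀ ℚ-ring

binom-zero : ∀ k → binom 0ℚ (suc k) ≡ 0ℚ
binom-zero zero    = refl
binom-zero (suc k) = trans (cong (λ q → q * (0ℚ - ↑ suc k) * (ℤ.+ 1 / suc (suc k))) (binom-zero k))
  (lem (0ℚ - ↑ suc k) (ℤ.+ 1 / suc (suc k)))
  where
  lem : ∀ a b → 0ℚ * a * b ≡ 0ℚ
  lem = solve-∀ ℚ-ring

-- (1 - z)ˣ
β : ℚ → Seq
β x i = -1^ i * binom x i

[1-z]-β : ∀ x → [1-z] (β x) ≗ β (1ℚ + x)
[1-z]-β x zero    = refl
[1-z]-β x (suc i) = begin
  (- (-1^ i)) * binom x (suc i) - -1^ i * binom x i ≡⟨ lem (-1^ i) (binom x (suc i)) (binom x i) ⟩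
  (- (-1^ i)) * (binom x (suc i) + binom x i)       ≡⟨ cong ((- (-1^ i)) *_) (pascal x i) ⟨
  (- (-1^ i)) * binom (1ℚ + x) (suc i) ∎
  where
  lem : ∀ s a b → (- s) * a - s * b ≡ (- s) * (a + b)
  lem = solve-∀ ℚ-ring

[1-z]^-β : ∀ r x → [1-z] ^ r · β x ≗ β (↑ r + x)
[1-z]^-β zero    x i = cong (λ q → β q i) (sym (ℚ.+-identityˡ x))
[1-z]^-β (suc r) x i = begin
  [1-z] ([1-z] ^ r · β x) i ≡⟨ op-cong [1-z]-linear ([1-z]^-β r x) i ⟩
  [1-z] (β (↑ r + x)) i     ≡⟨ [1-z]-β (↑ r + x) i ⟩
  β (1ℚ + (↑ r + x)) i      ≡⟨ cong (λ q → β q i) (trans (sym (ℚ.+-assoc 1ℚ (↑ r) x)) (cong (_+ x) (sym (↑-suc r)))) ⟩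
  β (↑ suc r + x) i ∎

β-zero : β 0ℚ ≗ δ₀
β-zero zero    = refl
β-zero (suc i) = trans (cong ((- (-1^ i)) *_) (binom-zero i)) (ℚ.*-zeroʳ (- (-1^ i)))

[1-z]^-δ₀ : ∀ a → [1-z] ^ a · δ₀ ≗ β (↑ a)
[1-z]^-δ₀ a i = begin
  ([1-z] ^ a · δ₀) i   ≡⟨ op-cong (^-linear [1-z]-linear a) β-zero i ⟨
  ([1-z] ^ a · β 0ℚ) i ≡⟨ [1-z]^-β a 0ℚ i ⟩
  β (↑ a + 0ℚ) i       ≡⟨ cong (λ q → β q i) (ℚ.+-identityʳ (↑ a)) ⟩
  β (↑ a) i ∎

-- `β (↑ d - ↑ r)` serves as the quotient of (1 - z)^d by (1 - z)^r, also when `d < r`.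
[1-z]^-β-minus : ∀ r d → [1-z] ^ r · β (↑ d - ↑ r) ≗ [1-z] ^ d · δ₀
[1-z]^-β-minus r d i = trans ([1-z]^-β r (↑ d - ↑ r) i)
  (trans (cong (λ q → β q i) (lem (↑ r) (↑ d))) (sym ([1-z]^-δ₀ d i)))
  where
  lem : ∀ r d → r + (d - r) ≡ d
  lem = solve-∀ ℚ-ring

[1+z]^-δ₀ : ∀ a → [1+z] ^ a · δ₀ ≗ binom (↑ a)
[1+z]^-δ₀ zero    zero    = refl
[1+z]^-δ₀ zero    (suc i) = sym (binom-zero i)
[1+z]^-δ₀ (suc a) zero    = trans (ℚ.+-identityʳ (([1+z] ^ a · δ₀) 0)) ([1+z]^-δ₀ a 0)
[1+z]^-δ₀ (suc a) (suc i) = begin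
  ([1+z] ^ a · δ₀) (suc i) + ([1+z] ^ a · δ₀) i ≡⟨ cong₂ _+_ ([1+z]^-δ₀ a (suc i)) ([1+z]^-δ₀ a i) ⟩
  binom (↑ a) (suc i) + binom (↑ a) i           ≡⟨ pascal (↑ a) i ⟨
  binom (1ℚ + ↑ a) (suc i)                      ≡⟨ cong (λ q → binom q (suc i)) (↑-suc a) ⟨
  binom (↑ suc a) (suc i) ∎

-- Cauchy products and cancellation

infixl 10 _⋆_
-- The order of summation and of the factors makes the sums in the theorem instances of this product
-- by definition.
_⋆_ : Seq → Seq → Seq
(f ⋆ g) w = ∑[ i ≤ w ] (f (w ∸ toℕ i) * g (toℕ i))

⋆-congˡ : ∀ {f f′} → f ≗ f′ → ∀ g → f ⋆ g ≗ f′ ⋆ g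
⋆-congˡ e g w = ℚΣ.sum-cong-≗ {suc w} (λ i → cong (_* g (toℕ i)) (e (w ∸ toℕ i)))

[1-z]-⋆ : ∀ f g → [1-z] (f ⋆ g) ≗ [1-z] f ⋆ g
[1-z]-⋆ f g zero = lem (f 0) (g 0)
  where
  lem : ∀ a b → (a * b + 0ℚ) - 0ℚ ≡ (a - 0ℚ) * b + 0ℚ
  lem = solve-∀ ℚ-ring
-- The induction peels off the term with index 0 from both products; here the shifted product has
-- nothing left after that, so this case is separate.
[1-z]-⋆ f g (suc zero) = lem (f 0) (f 1) (g 0) (g 1)
  where
  lem : ∀ a b c d → (b * c + (a * d + 0ℚ)) - (a * c + 0ℚ) ≡ (b - a) * c + ((a - 0ℚ) * d + 0ℚ)
  lem = solve-∀ ℚ-ring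
[1-z]-⋆ f g (suc (suc w)) = trans
  (lem (f (suc (suc w))) (f (suc w)) (g 0) ((f ⋆ (g ∘ suc)) (suc w)) ((f ⋆ (g ∘ suc)) w))
  (cong ((f (suc (suc w)) - f (suc w)) * g 0 +_) ([1-z]-⋆ f (g ∘ suc) (suc w)))
  where
  lem : ∀ a b c s t → (a * c + s) - (b * c + t) ≡ (a - b) * c + (s - t)
  lem = solve-∀ ℚ-ring

[1-z]^-⋆ : ∀ r f g → [1-z] ^ r · (f ⋆ g) ≗ ([1-z] ^ r · f) ⋆ g
[1-z]^-⋆ zero    f g w = refl
[1-z]^-⋆ (suc r) f g w = trans (op-cong [1-z]-linear ([1-z]^-⋆ r f g) w) ([1-z]-⋆ ([1-z] ^ r · f) g w)

δ₀-⋆ : ∀ g → δ₀ ⋆ g ≗ g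
δ₀-⋆ g zero    = lem (g 0)
  where
  lem : ∀ a → 1ℚ * a + 0ℚ ≡ a
  lem = solve-∀ ℚ-ring
δ₀-⋆ g (suc w) = trans (cong (0ℚ * g 0 +_) (δ₀-⋆ (g ∘ suc) w)) (lem (g 0) (g (suc w)))
  where
  lem : ∀ a b → 0ℚ * a + b ≡ b
  lem = solve-∀ ℚ-ring

[1-z]^-β-⋆ : ∀ r d g → [1-z] ^ r · (β (↑ d - ↑ r) ⋆ g) ≗ [1-z] ^ d · g
[1-z]^-β-⋆ r d g w = begin
  ([1-z] ^ r · (β (↑ d - ↑ r) ⋆ g)) w ≡⟨ [1-z]^-⋆ r (β (↑ d - ↑ r)) g w ⟩
  (([1-z] ^ r · β (↑ d - ↑ r)) ⋆ g) w ≡⟨ ⋆-congˡ ([1-z]^-β-minus r d) g w ⟩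
  (([1-z] ^ d · δ₀) ⋆ g) w            ≡⟨ [1-z]^-⋆ d δ₀ g w ⟨
  ([1-z] ^ d · (δ₀ ⋆ g)) w            ≡⟨ op-cong (^-linear [1-z]-linear d) (δ₀-⋆ g) w ⟩
  ([1-z] ^ d · g) w ∎

-- The constant term of `1 - z` is 1, so the coefficients are recovered one after another.
[1-z]-injective : ∀ {f g} → [1-z] f ≗ [1-z] g → f ≗ g
[1-z]-injective {f} {g} e zero    = trans (sym (ℚ.+-identityʳ (f 0))) (trans (e 0) (ℚ.+-identityʳ (g 0)))
[1-z]-injective {f} {g} e (suc j) = lem (f (suc j)) (g (suc j)) ([1-z]-injective {f} {g} e j) (e (suc j))
  where
  add-back : ∀ a c → a ≡ (a - c) + c
  add-back = solve-∀ ℚ-ring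
  lem : ∀ a b {c d} → c ≡ d → a - c ≡ b - d → a ≡ b
  lem a b {c} refl e = trans (add-back a c) (trans (cong (_+ c) e) (sym (add-back b c)))

[1-z]^-injective : ∀ r {f g} → [1-z] ^ r · f ≗ [1-z] ^ r · g → f ≗ g
[1-z]^-injective zero    e = e
[1-z]^-injective (suc r) {f} {g} e = [1-z]^-injective r ([1-z]-injective {[1-z] ^ r · f} {[1-z] ^ r · g} e)

-- Even and odd parts of a series

even odd : Seq → Seq
even f i = f (2 ℕ.* i)
odd f i  = f (2 ℕ.* i ℕ.+ 1)

-- A factor in z² preserves parity, and on either half it acts as `1 - z` in the new variable.
even-[1-z²] : ∀ f → even ([1-z²] f) ≗ [1-z] (even f)
even-[1-z²] f zero    = refl
even-[1-z²] f (suc i) = cong (λ q → f (2 ℕ.* suc i) - q) (cong (shift (shift f)) (ℕ.*-suc 2 i))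

odd-[1-z²] : ∀ f → odd ([1-z²] f) ≗ [1-z] (odd f)
odd-[1-z²] f zero    = refl
odd-[1-z²] f (suc i) = cong (λ q → f (2 ℕ.* suc i ℕ.+ 1) - q) (cong (shift (shift f)) (cong (ℕ._+ 1) (ℕ.*-suc 2 i)))

even-[1-z²]^ : ∀ r f → even ([1-z²] ^ r · f) ≗ [1-z] ^ r · even f
even-[1-z²]^ zero    f i = refl
even-[1-z²]^ (suc r) f i = trans (even-[1-z²] ([1-z²] ^ r · f) i) (op-cong [1-z]-linear (even-[1-z²]^ r f) i)

odd-[1-z²]^ : ∀ r f → odd ([1-z²] ^ r · f) ≗ [1-z] ^ r · odd f
odd-[1-z²]^ zero    f i = refl
odd-[1-z²]^ (suc r) f i = trans (odd-[1-z²] ([1-z²] ^ r · f) i) (op-cong [1-z]-linear (odd-[1-z²]^ r f) i)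

-1^even : ∀ i → -1^ (2 ℕ.* i) ≡ 1ℚ
-1^even zero    = refl
-1^even (suc i) = trans (cong -1^_ (ℕ.*-suc 2 i)) (trans (lem (-1^ (2 ℕ.* i))) (-1^even i))
  where
  lem : ∀ a → - - a ≡ a
  lem = solve-∀ ℚ-ring

even-β : ∀ x → even (β x) ≗ even (binom x)
even-β x i = trans (cong (_* binom x (2 ℕ.* i)) (-1^even i)) (ℚ.*-identityˡ (binom x (2 ℕ.* i)))

-1^+1 : ∀ i → -1^ (i ℕ.+ 1) ≡ - (-1^ i)
-1^+1 i = cong -1^_ (ℕ.+-comm i 1)

odd-β : ∀ x i → odd (β x) i ≡ - odd (binom x) i
odd-β x i = trans (cong (_* binom x (2 ℕ.* i ℕ.+ 1)) (trans (-1^+1 (2 ℕ.* i)) (cong -_ (-1^even i)))) (lem (binom x (2 ℕ.* i ℕ.+ 1)))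
  where
  lem : ∀ a → (- 1ℚ) * a ≡ - a
  lem = solve-∀ ℚ-ring

krawtchouk-evenˡ : ∀ d a → even (krawtchouk d (d ℕ.+ a)) ≗ [1-z] ^ d · even (binom (↑ a))
krawtchouk-evenˡ d a i = begin
  krawtchouk d (d ℕ.+ a) (2 ℕ.* i)         ≡⟨ cong (λ d′ → krawtchouk d′ (d ℕ.+ a) (2 ℕ.* i)) (ℕ.+-identityʳ d) ⟨
  krawtchouk (d ℕ.+ 0) (d ℕ.+ a) (2 ℕ.* i) ≡⟨ krawtchouk-+ d 0 a (2 ℕ.* i) ⟩
  even ([1-z²] ^ d · krawtchouk 0 a) i     ≡⟨ even-[1-z²]^ d (krawtchouk 0 a) i ⟩
  ([1-z] ^ d · even (krawtchouk 0 a)) i    ≡⟨ op-cong (^-linear [1-z]-linear d) (λ i → [1+z]^-δ₀ a (2 ℕ.* i)) i ⟩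
  ([1-z] ^ d · even (binom (↑ a))) i ∎

krawtchouk-oddˡ : ∀ d a → odd (krawtchouk d (d ℕ.+ a)) ≗ [1-z] ^ d · odd (binom (↑ a))
krawtchouk-oddˡ d a i = begin
  krawtchouk d (d ℕ.+ a) (2 ℕ.* i ℕ.+ 1)         ≡⟨ cong (λ d′ → krawtchouk d′ (d ℕ.+ a) (2 ℕ.* i ℕ.+ 1)) (ℕ.+-identityʳ d) ⟨
  krawtchouk (d ℕ.+ 0) (d ℕ.+ a) (2 ℕ.* i ℕ.+ 1) ≡⟨ krawtchouk-+ d 0 a (2 ℕ.* i ℕ.+ 1) ⟩
  odd ([1-z²] ^ d · krawtchouk 0 a) i            ≡⟨ odd-[1-z²]^ d (krawtchouk 0 a) i ⟩
  ([1-z] ^ d · odd (krawtchouk 0 a)) i           ≡⟨ op-cong (^-linear [1-z]-linear d) (λ i → [1+z]^-δ₀ a (2 ℕ.* i ℕ.+ 1)) i ⟩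
  ([1-z] ^ d · odd (binom (↑ a))) i ∎

krawtchouk-evenʳ : ∀ d a → even (krawtchouk (d ℕ.+ a) d) ≗ [1-z] ^ d · even (binom (↑ a))
krawtchouk-evenʳ d a i = begin
  krawtchouk (d ℕ.+ a) d (2 ℕ.* i)         ≡⟨ cong (λ d′ → krawtchouk (d ℕ.+ a) d′ (2 ℕ.* i)) (ℕ.+-identityʳ d) ⟨
  krawtchouk (d ℕ.+ a) (d ℕ.+ 0) (2 ℕ.* i) ≡⟨ krawtchouk-+ d a 0 (2 ℕ.* i) ⟩
  even ([1-z²] ^ d · krawtchouk a 0) i     ≡⟨ even-[1-z²]^ d (krawtchouk a 0) i ⟩
  ([1-z] ^ d · even (krawtchouk a 0)) i    ≡⟨ op-cong (^-linear [1-z]-linear d)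
                                                (λ i → trans ([1-z]^-δ₀ a (2 ℕ.* i)) (even-β (↑ a) i)) i ⟩
  ([1-z] ^ d · even (binom (↑ a))) i ∎

-- Replacing `1 + z` by `1 - z` reverses the odd coefficients and keeps the even ones. So a
-- difference of the two outer enumerators doubles in odd degree, and their sum doubles in even
-- degree.
krawtchouk-oddʳ : ∀ d a i → odd (krawtchouk (d ℕ.+ a) d) i ≡ - ([1-z] ^ d · odd (binom (↑ a))) i
krawtchouk-oddʳ d a i = begin
  krawtchouk (d ℕ.+ a) d (2 ℕ.* i ℕ.+ 1)         ≡⟨ cong (λ d′ → krawtchouk (d ℕ.+ a) d′ (2 ℕ.* i ℕ.+ 1)) (ℕ.+-identityʳ d) ⟨
  krawtchouk (d ℕ.+ a) (d ℕ.+ 0) (2 ℕ.* i ℕ.+ 1) ≡⟨ krawtchouk-+ d a 0 (2 ℕ.* i ℕ.+ 1) ⟩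
  odd ([1-z²] ^ d · krawtchouk a 0) i            ≡⟨ odd-[1-z²]^ d (krawtchouk a 0) i ⟩
  ([1-z] ^ d · odd (krawtchouk a 0)) i           ≡⟨ op-cong (^-linear [1-z]-linear d)
                                                      (λ i → trans ([1-z]^-δ₀ a (2 ℕ.* i ℕ.+ 1)) (trans (odd-β (↑ a) i) (neg (binom (↑ a) (2 ℕ.* i ℕ.+ 1))))) i ⟩
  ([1-z] ^ d · (λ i → (- 1ℚ) * odd (binom (↑ a)) i)) i ≡⟨ op-* (^-linear [1-z]-linear d) (- 1ℚ) (odd (binom (↑ a))) i ⟩
  (- 1ℚ) * ([1-z] ^ d · odd (binom (↑ a))) i     ≡⟨ neg (([1-z] ^ d · odd (binom (↑ a))) i) ⟨
  - ([1-z] ^ d · odd (binom (↑ a))) i ∎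
  where
  neg : ∀ a → - a ≡ (- 1ℚ) * a
  neg = solve-∀ ℚ-ring

krawtchouk-central : ∀ m → even (krawtchouk m m) ≗ [1-z] ^ m · δ₀
krawtchouk-central m i = begin
  krawtchouk m m (2 ℕ.* i)                 ≡⟨ cong (λ m′ → krawtchouk m′ m′ (2 ℕ.* i)) (ℕ.+-identityʳ m) ⟨
  krawtchouk (m ℕ.+ 0) (m ℕ.+ 0) (2 ℕ.* i) ≡⟨ krawtchouk-+ m 0 0 (2 ℕ.* i) ⟩
  even ([1-z²] ^ m · δ₀) i                 ≡⟨ even-[1-z²]^ m δ₀ i ⟩
  ([1-z] ^ m · even δ₀) i                  ≡⟨ op-cong (^-linear [1-z]-linear m) (λ { zero → refl ; (suc i) → refl }) i ⟩
  ([1-z] ^ m · δ₀) i ∎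

-- The two sides agree after multiplication by (1 - z)^r, which can be cancelled; this lowers the
-- exponent from `d` to `d - r`.
odd-coefficient : ∀ r d a g {Y} →
  (∀ j → ([1-z²] ^ r · Y) j ≡ g * (krawtchouk d (d ℕ.+ a) j - krawtchouk (d ℕ.+ a) d j)) →
  ∀ w → odd Y w ≡ (g * (1ℚ + 1ℚ)) * (β (↑ d - ↑ r) ⋆ odd (binom (↑ a))) w
odd-coefficient r d a g {Y} e = [1-z]^-injective r λ i → begin
  ([1-z] ^ r · odd Y) i ≡⟨ odd-[1-z²]^ r Y i ⟨
  odd ([1-z²] ^ r · Y) i ≡⟨ e (2 ℕ.* i ℕ.+ 1) ⟩
  g * (odd (krawtchouk d (d ℕ.+ a)) i - odd (krawtchouk (d ℕ.+ a) d) i)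
    ≡⟨ cong₂ (λ p q → g * (p - q)) (krawtchouk-oddˡ d a i) (krawtchouk-oddʳ d a i) ⟩
  g * (Z i - - Z i) ≡⟨ lem g (Z i) ⟩
  (g * (1ℚ + 1ℚ)) * Z i ≡⟨ cong ((g * (1ℚ + 1ℚ)) *_) ([1-z]^-β-⋆ r d (odd (binom (↑ a))) i) ⟨
  (g * (1ℚ + 1ℚ)) * ([1-z] ^ r · (β (↑ d - ↑ r) ⋆ odd (binom (↑ a)))) i
    ≡⟨ op-* (^-linear [1-z]-linear r) (g * (1ℚ + 1ℚ)) (β (↑ d - ↑ r) ⋆ odd (binom (↑ a))) i ⟨
  ([1-z] ^ r · (λ w → (g * (1ℚ + 1ℚ)) * (β (↑ d - ↑ r) ⋆ odd (binom (↑ a))) w)) i ∎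
  where
  Z = [1-z] ^ d · odd (binom (↑ a))
  lem : ∀ g z → g * (z - - z) ≡ (g * (1ℚ + 1ℚ)) * z
  lem = solve-∀ ℚ-ring

even-coefficient : ∀ r d a m g {Y} →
  (∀ j → ([1-z²] ^ r · Y) j ≡ g * (krawtchouk d (d ℕ.+ a) j + krawtchouk (d ℕ.+ a) d j - (1ℚ + 1ℚ) * krawtchouk m m j)) →
  ∀ w → even Y w ≡ (g * (1ℚ + 1ℚ)) * ((β (↑ d - ↑ r) ⋆ even (binom (↑ a))) w - β (↑ m - ↑ r) w)
even-coefficient r d a m g {Y} e = [1-z]^-injective r λ i → begin
  ([1-z] ^ r · even Y) i ≡⟨ even-[1-z²]^ r Y i ⟨
  even ([1-z²] ^ r · Y) i ≡⟨ e (2 ℕ.* i) ⟩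
  g * (even (krawtchouk d (d ℕ.+ a)) i + even (krawtchouk (d ℕ.+ a) d) i - (1ℚ + 1ℚ) * even (krawtchouk m m) i)
    ≡⟨ cong₂ (λ p q → g * (p - (1ℚ + 1ℚ) * q)) (cong₂ _+_ (krawtchouk-evenˡ d a i) (krawtchouk-evenʳ d a i)) (krawtchouk-central m i) ⟩
  g * (Z i + Z i - (1ℚ + 1ℚ) * ([1-z] ^ m · δ₀) i) ≡⟨ lem g (Z i) (([1-z] ^ m · δ₀) i) ⟩
  (g * (1ℚ + 1ℚ)) * (Z i - ([1-z] ^ m · δ₀) i)
    ≡⟨ cong ((g * (1ℚ + 1ℚ)) *_) (cong₂ _-_ ([1-z]^-β-⋆ r d (even (binom (↑ a))) i) ([1-z]^-β-minus r m i)) ⟨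
  (g * (1ℚ + 1ℚ)) * (([1-z] ^ r · P) i - ([1-z] ^ r · Q) i)
    ≡⟨ cong ((g * (1ℚ + 1ℚ)) *_) (op-- L P Q i) ⟨
  (g * (1ℚ + 1ℚ)) * ([1-z] ^ r · (λ w → P w - Q w)) i ≡⟨ op-* L (g * (1ℚ + 1ℚ)) (λ w → P w - Q w) i ⟨
  ([1-z] ^ r · (λ w → (g * (1ℚ + 1ℚ)) * (P w - Q w))) i ∎
  where
  L = ^-linear [1-z]-linear r
  Z = [1-z] ^ d · even (binom (↑ a))
  P = β (↑ d - ↑ r) ⋆ even (binom (↑ a))
  Q = β (↑ m - ↑ r)
  lem : ∀ g z t → g * (z + z - (1ℚ + 1ℚ) * t) ≡ (g * (1ℚ + 1ℚ)) * (z - t)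
  lem = solve-∀ ℚ-ring

gap-ℚ : ∀ {n d a} → n ≡ d ℕ.+ (d ℕ.+ a) → ↑ n - ↑ 2 * ↑ d ≡ ↑ a
gap-ℚ {n} {d} {a} refl = trans (cong (λ q → q - ↑ 2 * ↑ d) (trans (↑-homo-+ d (d ℕ.+ a)) (cong (λ q → ↑ d + q) (↑-homo-+ d a)))) (lem (↑ d) (↑ a))
  where
  lem : ∀ d a → d + (d + a) - (1ℚ + 1ℚ) * d ≡ a
  lem = solve-∀ ℚ-ring

-- Pigeonhole, and sets meeting a word in a given parity

unique-length≤ : ∀ lo m {xs} → Unique xs → (∀ {x} → x ∈ xs → lo ℕ.≤ x × x ℕ.< lo ℕ.+ m) → length xs ℕ.≤ m
unique-length≤ lo zero {[]}     xs! bound = ℕ.z≤n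
unique-length≤ lo zero {x ∷ xs} xs! bound with bound (here refl)
... | lo≤x , x<lo = contradiction lo≤x (ℕ.<⇒≱ (subst (x ℕ.<_) (ℕ.+-identityʳ lo) x<lo))
unique-length≤ lo (suc m) {xs} xs! bound with (lo ℕ.+ m) ∈? xs
... | no ∉xs = ℕ.m≤n⇒m≤1+n (unique-length≤ lo m xs! λ {x} x∈ → proj₁ (bound x∈) ,
  ℕ.≤∧≢⇒< (ℕ.≤-pred (subst (x ℕ.<_) (ℕ.+-suc lo m) (proj₂ (bound x∈)))) λ { refl → ∉xs x∈ })
... | yes ∈xs with remove xs! ∈xs
...   | ys , len , ∉ys , split , ys! , ys⊆ = subst (ℕ._≤ suc m) (sym len) (ℕ.s≤s (unique-length≤ lo m ys! λ {x} x∈ →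
  proj₁ (bound (ys⊆ x∈)) , ℕ.≤∧≢⇒< (ℕ.≤-pred (subst (x ℕ.<_) (ℕ.+-suc lo m) (proj₂ (bound (ys⊆ x∈))))) λ { refl → ∉ys x∈ }))

-- The witness is disjoint from `y`, for which the complement of `y` has enough points.
even-intersection : ∀ {n} (y : Word n) q → q ℕ.+ wt y ℕ.≤ n → ∃[ S ] wt S ≡ q × ⟨ S , y ⟩ ≡ 0ℙ
even-intersection []       zero    _ = [] , refl , refl
even-intersection (0ℙ ∷ y) zero    _ with even-intersection y zero (wt≤n y)
... | S , w≡ , e = 0ℙ ∷ S , w≡ , e
even-intersection (0ℙ ∷ y) (suc q) (ℕ.s≤s q≤) with even-intersection y q q≤
... | S , w≡ , e = 1ℙ ∷ S , cong suc w≡ , e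
even-intersection {suc n} (1ℙ ∷ y) q q≤ with even-intersection y q (ℕ.≤-pred (subst (ℕ._≤ suc n) (ℕ.+-suc q (wt y)) q≤))
... | S , w≡ , e = 0ℙ ∷ S , w≡ , e

-- The witness consists of the first point of `y` and `q` points outside `y`.
odd-intersection : ∀ {n} (y : Word n) q → wt y ≢ 0 → q ℕ.+ wt y ℕ.≤ n → ∃[ S ] wt S ≡ suc q × ⟨ S , y ⟩ ≡ 1ℙ
odd-intersection []       q       y≢0 _ = contradiction refl y≢0
odd-intersection (0ℙ ∷ y) zero    y≢0 _ with odd-intersection y zero y≢0 (wt≤n y)
... | S , w≡ , e = 0ℙ ∷ S , w≡ , e
odd-intersection (0ℙ ∷ y) (suc q) y≢0 (ℕ.s≤s q≤) with odd-intersection y q y≢0 q≤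
... | S , w≡ , e = 1ℙ ∷ S , cong suc w≡ , e
odd-intersection {suc n} (1ℙ ∷ y) q _ q≤ with even-intersection y q (ℕ.≤-pred (subst (ℕ._≤ suc n) (ℕ.+-suc q (wt y)) q≤))
... | S , w≡ , e = 1ℙ ∷ S , cong suc w≡ , cong ℙ._⁻¹ e

-- `𝟎` and `𝟏` are the only words of these weights, so the weights 0 and n cancel from every
-- comparison of sets of equal size.
χ-extreme : ∀ {n} (c x y : Word n) → wt x ≡ wt y → wt c ≡ 0 ⊎ wt c ≡ n → χ c x ≡ χ c y
χ-extreme c x y wt≡ (inj₁ e) rewrite wt≡0⇒𝟎 c e = cong sgn (trans (⟨𝟎,⟩ x) (sym (⟨𝟎,⟩ y)))
χ-extreme c x y wt≡ (inj₂ e) rewrite wt≡n⇒𝟏 c e = trans (χ-𝟏 x) (trans (cong -1^_ wt≡) (sym (χ-𝟏 y)))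

-- The weights of the code

module Weights {n k d d⊥ t} (C : Pred (Word n) 0ℓ) (C-sub : IsSubspace C) (b : Fin k → Word n) (b-basis : IsBasis C b)
  (𝟏∈C : C (𝟏 n)) (C-min : IsMinimumDistance C d) (⊥-min : IsMinimumDistance (C ⊥) d⊥)
  (U : List ℕ) (U! : Unique U)
  (U-sound : ∀ {u} → u ∈ U → ∃ (C at-weight u) × 0 ℕ.< u × u ℕ.+ t ℕ.≤ n)
  (U-complete : ∀ {c} → C c → 0 ℕ.< wt c → wt c ℕ.+ t ℕ.≤ n → wt c ∈ U)
  (U-length : length U ℕ.+ t ≡ d⊥) (1≤t : 1 ℕ.≤ t) (t+t≤d⊥ : t ℕ.+ t ℕ.≤ d⊥) (2≤U : 2 ℕ.≤ length U)
  where

  open Code C C-sub b b-basis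
  open Strength (IsMinimumDistance.minimal ⊥-min)

  private
    cw : Word k → Word n
    cw a = linearCombination a b

  d⊥≤n : d⊥ ℕ.≤ n
  d⊥≤n with IsMinimumDistance.attained ⊥-min
  ... | y , _ , _ , w≡ = subst (ℕ._≤ n) w≡ (wt≤n y)

  d≤wt : ∀ {c} → C c → wt c ≢ 0 → d ℕ.≤ wt c
  d≤wt c∈ w≢0 = IsMinimumDistance.minimal C-min c∈ λ { refl → w≢0 (wt-𝟎 n) }

  -- The complement `𝟏 n ⊕ c` is again a codeword, and it is nonzero.
  wt+d≤n : ∀ {c} → C c → wt c ≢ n → wt c ℕ.+ d ℕ.≤ n
  wt+d≤n {c} c∈ w≢n = subst (wt c ℕ.+ d ℕ.≤_) (trans (ℕ.+-comm (wt c) (wt (𝟏 n ⊕ c))) (wt-𝟏⊕ c))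
    (ℕ.+-monoʳ-≤ (wt c) (d≤wt (IsSubspace.⊕-closed C-sub 𝟏∈C c∈) λ e → w≢n (trans (cong (ℕ._+ wt c) (sym e)) (wt-𝟏⊕ c))))

  1≤d : 1 ℕ.≤ d
  1≤d with IsMinimumDistance.attained C-min
  ... | c , _ , c≢0 , w≡ = ℕ.n≢0⇒n>0 λ d≡0 → c≢0 (wt≡0⇒𝟎 c (trans w≡ d≡0))

  U-bounds : ∀ {u} → u ∈ U → d ℕ.≤ u × u ℕ.+ d ℕ.≤ n
  U-bounds {u} u∈ with U-sound u∈
  ... | (c , c∈ , refl) , 0<u , u+t≤n =
    d≤wt c∈ (ℕ.>⇒≢ 0<u) , wt+d≤n c∈ λ e → ℕ.<⇒≱ (ℕ.m<m+n (wt c) 1≤t) (subst (wt c ℕ.+ t ℕ.≤_) (sym e) u+t≤n)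

  d+t≤n⇒d∈U : d ℕ.+ t ℕ.≤ n → d ∈ U
  d+t≤n⇒d∈U d+t≤n with IsMinimumDistance.attained C-min
  ... | c , c∈ , _ , w≡ = subst (_∈ U) w≡ (U-complete c∈ (subst (0 ℕ.<_) (sym w≡) 1≤d) (subst (λ w → w ℕ.+ t ℕ.≤ n) (sym w≡) d+t≤n))

  -- If d < t, then there are at most d⊥ - d weights, so the sum of χ_S over the words of weight d
  -- depends only on |S| for |S| ≤ d.  Hence so does, for |S| = d, the number of codewords with support S:
  -- every word of weight d lies in C, although some of them meet a minimum word of C⊥ in one point.
  module _ (d<t : d ℕ.< t) where

    private
      d+t≤n : d ℕ.+ t ℕ.≤ n
      d+t≤n = ℕ.≤-trans (ℕ.+-monoˡ-≤ t (ℕ.<⇒≤ d<t)) (ℕ.≤-trans t+t≤d⊥ d⊥≤n)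

      d∈U : d ∈ U
      d∈U = d+t≤n⇒d∈U d+t≤n

      -- The values n - d, n - d - 1, ..., n - t + 1: the weights a word other than `𝟏` could have
      -- beyond the range recorded in `U`.
      high : List ℕ
      high = List.applyUpTo (λ i → n ∸ (d ℕ.+ i)) (t ∸ d)

      i<t∸d⇒d+i<t : ∀ {i} → i ℕ.< t ∸ d → d ℕ.+ i ℕ.< t
      i<t∸d⇒d+i<t i< = subst (_ ℕ.<_) (ℕ.m+[n∸m]≡n (ℕ.<⇒≤ d<t)) (ℕ.+-monoʳ-< d i<)

      d∉high : d ∉ high
      d∉high m with ∈-applyUpTo⁻ (λ i → n ∸ (d ℕ.+ i)) m
      ... | i , i< , e = ℕ.<⇒≱ (ℕ.+-monoʳ-< d (i<t∸d⇒d+i<t i<)) (ℕ.≤-trans d+t≤n (ℕ.≤-reflexive n≡))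
        where
        n≡ : n ≡ d ℕ.+ (d ℕ.+ i)
        n≡ = trans (sym (ℕ.m∸n+n≡m (ℕ.≤-trans (ℕ.<⇒≤ (i<t∸d⇒d+i<t i<)) (ℕ.≤-trans (ℕ.m≤n+m t d) d+t≤n)))) (cong (ℕ._+ (d ℕ.+ i)) (sym e))

      -- The `t - d` additional roots from `high` are paid for by allowing only weights up to `d`
      -- instead of `t`: altogether d + (|U| - 1) + (t - d) = d⊥ - 1.
      F-at-d : ∀ x y → wt x ≡ wt y → wt x ℕ.≤ d → F x (at d) ≡ F y (at d)
      F-at-d x y wt≡ x≤d with remove U! d∈U
      ... | U′ , len , d∉U′ , split , _ = Pair.F-at-≡ x y wt≡ {d} {U′ List.++ high} short d∉ cover′
        where
        d∉ : d ∉ U′ List.++ high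
        d∉ m = [ d∉U′ , d∉high ]′ (∈-++⁻ U′ m)
        short : wt x ℕ.+ length (U′ List.++ high) ℕ.< d⊥
        short = subst (wt x ℕ.+ length (U′ List.++ high) ℕ.<_) U-length (ℕ.≤-<-trans (ℕ.+-monoˡ-≤ _ x≤d) (ℕ.≤-reflexive (begin
          suc (d ℕ.+ length (U′ List.++ high)) ≡⟨ cong (λ l → suc (d ℕ.+ l)) (trans (length-++ U′) (cong (length U′ ℕ.+_) (length-applyUpTo _ (t ∸ d)))) ⟩
          suc (d ℕ.+ (length U′ ℕ.+ (t ∸ d)))  ≡⟨ arith d (length U′) (t ∸ d) ⟩
          suc (length U′) ℕ.+ (d ℕ.+ (t ∸ d))  ≡⟨ cong₂ ℕ._+_ (sym len) (ℕ.m+[n∸m]≡n (ℕ.<⇒≤ d<t)) ⟩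
          length U ℕ.+ t ∎)))
          where
          arith : ∀ a b c → suc (a ℕ.+ (b ℕ.+ c)) ≡ suc b ℕ.+ (a ℕ.+ c)
          arith = ℕ-Solver.solve-∀
        ∈-split : ∀ {u} → u ∈ d ∷ U′ → u ∈ d ∷ (U′ List.++ high)
        ∈-split (here e)  = here e
        ∈-split (there m) = there (∈-++⁺ˡ m)
        cover′ : ∀ a → χ (cw a) x ≡ χ (cw a) y ⊎ wt (cw a) ∈ d ∷ (U′ List.++ high)
        cover′ a with wt (cw a) ℕ.≟ 0 | wt (cw a) ℕ.≟ n
        ... | yes e | _     = inj₁ (χ-extreme (cw a) x y wt≡ (inj₁ e))
        ... | no _  | yes e = inj₁ (χ-extreme (cw a) x y wt≡ (inj₂ e))
        ... | no w≢0 | no w≢n with wt (cw a) ℕ.+ t ℕ.≤? n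
        ...   | yes u+t≤n = inj₂ (∈-split (split (U-complete (cw∈C a) (ℕ.n≢0⇒n>0 w≢0) u+t≤n)))
        ...   | no ¬u+t≤n with ℕ.m≤n⇒∃[o]m+o≡n (wt+d≤n (cw∈C a) w≢n)
        ...     | i , u+d+i≡n = inj₂ (there (∈-++⁺ʳ U′ (subst (_∈ high) n∸≡u (∈-applyUpTo⁺ (λ i → n ∸ (d ℕ.+ i)) i<))))
          where
          u = wt (cw a)
          u+[d+i]≡n : u ℕ.+ (d ℕ.+ i) ≡ n
          u+[d+i]≡n = trans (sym (ℕ.+-assoc u d i)) u+d+i≡n
          n∸≡u : n ∸ (d ℕ.+ i) ≡ u
          n∸≡u = trans (cong (_∸ (d ℕ.+ i)) (sym u+[d+i]≡n)) (ℕ.m+n∸n≡m u (d ℕ.+ i))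
          i< : i ℕ.< t ∸ d
          i< = ℕ.m+n≤o⇒m≤o∸n (suc i) (subst (λ l → suc l ℕ.≤ t) (ℕ.+-comm d i)
            (ℕ.+-cancelˡ-< u (d ℕ.+ i) t (subst (ℕ._< u ℕ.+ t) (sym u+[d+i]≡n) (ℕ.≰⇒> ¬u+t≤n))))

      multiplicity : Word n → ℚ
      multiplicity S = ∑ʷ (λ a → ⟦ cw a ≟ʷ S ⟧)

      -- Among the words of weight `d`, only `S` itself covers `S`, so Möbius inversion isolates it.
      alt-F : ∀ S → wt S ≡ d → alt id S (λ R _ → F R (at d)) 0 ≡ [-2]^ d * multiplicity S
      alt-F S refl = begin
        alt id S (λ R _ → F R (at d)) 0
          ≡⟨ alt-∑ʷ id-linear S (λ a R _ → χ (cw a) R * at d (wt (cw a))) 0 ⟩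
        ∑ʷ (λ a → alt id S (λ R _ → χ (cw a) R * at d (wt (cw a))) 0) ≡⟨ ∑ʷ-cong (λ a → begin
          alt id S (λ R _ → χ (cw a) R * at d (wt (cw a))) 0
            ≡⟨ alt-cong id-linear S (λ R _ _ → ℚ.*-comm (χ (cw a) R) (at d (wt (cw a)))) 0 ⟩
          alt id S (λ R _ → at d (wt (cw a)) * χ (cw a) R) 0
            ≡⟨ alt-linear id-linear S (scale-linear (at d (wt (cw a)))) (λ _ _ → refl) (λ R _ → χ (cw a) R) 0 ⟩
          at d (wt (cw a)) * altχ S (cw a) ≡⟨ diagonal (cw a) ⟩
          [-2]^ d * ⟦ cw a ≟ʷ S ⟧ ∎) ⟩
        ∑ʷ (λ a → [-2]^ d * ⟦ cw a ≟ʷ S ⟧) ≡⟨ ∑ʷ-*ˡ ([-2]^ d) (λ a → ⟦ cw a ≟ʷ S ⟧) ⟩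
        [-2]^ d * multiplicity S ∎
        where
        diagonal : ∀ c → at (wt S) (wt c) * altχ S c ≡ [-2]^ wt S * ⟦ c ≟ʷ S ⟧
        diagonal c with c ≟ʷ S | wt c ℕ.≟ wt S
        ... | yes refl | yes _ = trans (ℚ.*-identityˡ (altχ S S)) (trans (altχ-diagonal S) (sym (ℚ.*-identityʳ ([-2]^ wt S))))
        ... | yes refl | no w≢ = contradiction refl w≢
        ... | no c≢S   | yes w≡ = trans (ℚ.*-identityˡ (altχ S c))
          (trans (altχ-off-diagonal S c (ℕ.≤-reflexive w≡) (c≢S ∘ sym)) (sym (ℚ.*-zeroʳ ([-2]^ wt S))))
        ... | no c≢S   | no _   = trans (ℚ.*-zeroˡ (altχ S c)) (sym (ℚ.*-zeroʳ ([-2]^ wt S)))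

      -- By `alt-radial` the inverted sums agree for all sets of size `d`; hence either all words of
      -- weight `d` are codewords or none is.
      multiplicity-const : ∀ S S′ → wt S ≡ d → wt S′ ≡ d → multiplicity S ≡ 0ℚ → multiplicity S′ ≡ 0ℚ
      multiplicity-const S S′ S≡ S′≡ S∉ = x*y≡0⇒y≡0 ([-2]^≢0 d) (begin
        [-2]^ d * multiplicity S′         ≡⟨ alt-F S′ S′≡ ⟨
        alt id S′ (λ R _ → F R (at d)) 0  ≡⟨ x-y≡0⇒x≡y (trans
          (alt-radial id-linear S′ S wt≡ (λ R R′ R≡ R< _ → F-at-d R R′ R≡ (ℕ.<⇒≤ (subst (wt R ℕ.<_) S′≡ R<))) 0)
          (x≡y⇒x-y≡0 (F-at-d S′ S wt≡ (ℕ.≤-reflexive S′≡)))) ⟩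
        alt id S (λ R _ → F R (at d)) 0   ≡⟨ alt-F S S≡ ⟩
        [-2]^ d * multiplicity S          ≡⟨ cong ([-2]^ d *_) S∉ ⟩
        [-2]^ d * 0ℚ                      ≡⟨ ℚ.*-zeroʳ ([-2]^ d) ⟩
        0ℚ ∎)
        where
        wt≡ = trans S′≡ (sym S≡)

      -- The members of `U` lie between `d` and `n - t`, so |U| ≤ n - t - d + 1; adding `t` bounds
      -- `d⊥`.
      d∸1+d⊥≤n : d ∸ 1 ℕ.+ d⊥ ℕ.≤ n
      d∸1+d⊥≤n with ℕ.m≤n⇒∃[o]m+o≡n d+t≤n
      ... | e , d+t+e≡n = ℕ.≤-pred (subst₂ ℕ._≤_ (trans (arith (length U) d t) (cong₂ ℕ._+_ (sym (ℕ.m+[n∸m]≡n 1≤d)) U-length)) (trans (cong suc (ℕ.+-comm e (d ℕ.+ t))) (cong suc d+t+e≡n))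
        (ℕ.+-monoˡ-≤ (d ℕ.+ t) (unique-length≤ d (suc e) U! λ {u} u∈ → proj₁ (U-bounds u∈) , ℕ.+-cancelʳ-< t u (d ℕ.+ suc e)
          (ℕ.≤-<-trans (proj₂ (proj₂ (U-sound u∈))) (ℕ.≤-reflexive (trans (cong suc (sym d+t+e≡n)) (arith′ d t e)))))))
        where
        arith : ∀ l d t → l ℕ.+ (d ℕ.+ t) ≡ d ℕ.+ (l ℕ.+ t)
        arith = ℕ-Solver.solve-∀
        arith′ : ∀ d t e → suc (d ℕ.+ t ℕ.+ e) ≡ d ℕ.+ suc e ℕ.+ t
        arith′ = ℕ-Solver.solve-∀

    d≮t : ⊥′
    d≮t with IsMinimumDistance.attained ⊥-min | IsMinimumDistance.attained C-min
    -- A set of size `d` with one point in `y` and the other `d - 1` outside is not orthogonal to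
    -- `y`, so it is not the support of a codeword.
    ... | y , y∈ , y≢𝟎 , y≡ | v , v∈ , _ , v≡ with odd-intersection y (d ∸ 1) (y≢𝟎 ∘ wt≡0⇒𝟎 y) (subst (λ w → d ∸ 1 ℕ.+ w ℕ.≤ n) (sym y≡) d∸1+d⊥≤n)
    ...   | S , S≡ , odd≡ with IsBasis.spanning b-basis v∈
    ...     | a₀ , refl = ∑ʷ-⟦⟧≡0⇒none (λ a → cw a ≟ʷ cw a₀)
      (multiplicity-const S (cw a₀) (trans S≡ (ℕ.m+[n∸m]≡n 1≤d)) v≡ (∑ʷ-zero (λ a → ⟦⟧-no (cw a ≟ʷ S) λ { refl → 0≢1 (trans (sym (y∈ (cw a) (cw∈C a))) odd≡) }))) a₀ refl
      where
      0≢1 : 0ℙ ≢ 1ℙ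
      0≢1 ()

  t≤d : t ℕ.≤ d
  t≤d = ℕ.≮⇒≥ d≮t

  -- With `t ≤ d`, a weight at most `n - d` is at most `n - t`, hence within the range that `U`
  -- records.
  wt-trichotomy : ∀ {c} → C c → (wt c ≡ 0 ⊎ wt c ≡ n) ⊎ wt c ∈ U
  wt-trichotomy {c} c∈ with wt c ℕ.≟ 0 | wt c ℕ.≟ n
  ... | yes e  | _      = inj₁ (inj₁ e)
  ... | no _   | yes e  = inj₁ (inj₂ e)
  ... | no w≢0 | no w≢n = inj₂ (U-complete c∈ (ℕ.n≢0⇒n>0 w≢0) (ℕ.≤-trans (ℕ.+-monoʳ-≤ (wt c) t≤d) (wt+d≤n c∈ w≢n)))

  U-complement : ∀ {u} → u ∈ U → ∃[ v ] u ℕ.+ v ≡ n × v ∈ U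
  U-complement {u} u∈ with U-sound u∈ | U-bounds u∈
  ... | (c , c∈ , refl) , 0<u , _ | d≤u , _ = wt (𝟏 n ⊕ c) , c+c′ , U-complete (IsSubspace.⊕-closed C-sub 𝟏∈C c∈)
    (ℕ.n≢0⇒n>0 λ e → ℕ.<⇒≱ (ℕ.m<m+n (wt c) 1≤t) (ℕ.≤-trans (proj₂ (proj₂ (U-sound u∈))) (ℕ.≤-reflexive (trans (sym c+c′) (trans (cong (wt c ℕ.+_) e) (ℕ.+-identityʳ (wt c)))))))
    (subst (wt (𝟏 n ⊕ c) ℕ.+ t ℕ.≤_) (wt-𝟏⊕ c) (ℕ.+-monoʳ-≤ (wt (𝟏 n ⊕ c)) (ℕ.≤-trans t≤d d≤u)))
    where
    c+c′ : wt c ℕ.+ wt (𝟏 n ⊕ c) ≡ n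
    c+c′ = trans (ℕ.+-comm (wt c) (wt (𝟏 n ⊕ c))) (wt-𝟏⊕ c)

  d∈U : d ∈ U
  d∈U with nonempty U 2≤U
    where
    nonempty : ∀ xs → 2 ℕ.≤ length xs → ∃[ u ] u ∈ xs
    nonempty (u ∷ _) _ = u , here refl
  ... | u , u∈ with U-bounds u∈
  ...   | d≤u , u+d≤n = d+t≤n⇒d∈U (ℕ.≤-trans (ℕ.+-monoʳ-≤ d t≤d) (ℕ.≤-trans (ℕ.+-monoˡ-≤ d d≤u) u+d≤n))

  ∃-gap : ∃[ a ] n ≡ d ℕ.+ (d ℕ.+ a)
  ∃-gap with U-bounds d∈U
  ... | _ , d+d≤n with ℕ.m≤n⇒∃[o]m+o≡n d+d≤n
  ...   | a , e = a , trans (sym e) (ℕ.+-assoc d d a)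

  -- Two or three weights, symmetric about n/2

  module Gap {a} (n≡ : n ≡ d ℕ.+ (d ℕ.+ a)) where

    complement-d : d ℕ.+ a ∈ U
    complement-d with U-complement d∈U
    ... | v , d+v≡n , v∈ = subst (_∈ U) (ℕ.+-cancelˡ-≡ d v (d ℕ.+ a) (trans d+v≡n n≡)) v∈

    ≤d+a : ∀ {u} → u ∈ U → u ℕ.≤ d ℕ.+ a
    ≤d+a {u} u∈ = ℕ.+-cancelʳ-≤ d u (d ℕ.+ a) (ℕ.≤-trans (proj₂ (U-bounds u∈)) (ℕ.≤-reflexive (trans n≡ (ℕ.+-comm d (d ℕ.+ a)))))

    a≢0 : a ≢ 0
    a≢0 refl = 2≰1 (ℕ.≤-trans 2≤U (unique-length≤ d 1 U! λ u∈ →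
      proj₁ (U-bounds u∈) , ℕ.≤-<-trans (≤d+a u∈) (ℕ.+-monoʳ-< d (ℕ.s≤s ℕ.z≤n))))
      where
      2≰1 : ¬ (2 ℕ.≤ 1)
      2≰1 (ℕ.s≤s ())

    d≢d+a : d ≢ d ℕ.+ a
    d≢d+a e = a≢0 (sym (ℕ.+-cancelˡ-≡ d 0 a (trans (ℕ.+-identityʳ d) e)))

    pair : length U ≡ 2 → ∀ {u} → u ∈ U → u ∈ d ∷ (d ℕ.+ a) ∷ []
    pair len with remove U! d∈U
    ... | x ∷ [] , _ , _ , split , _ , _ with split complement-d
    ...   | here e = contradiction (sym e) d≢d+a
    ...   | there (here refl) = split
    pair len | [] , len′ , _ with trans (sym len) len′
    ... | ()
    pair len | _ ∷ _ ∷ _ , len′ , _ with trans (sym len) len′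
    ... | ()

    -- The complement u ↦ n - u permutes `U` and exchanges `d` with `d + a`, so it fixes the third
    -- weight. In particular n is even.
    triple : length U ≡ 3 → ∃[ m ] n ≡ m ℕ.+ m × m ≢ d × m ≢ d ℕ.+ a × (∀ {u} → u ∈ U → u ∈ d ∷ m ∷ (d ℕ.+ a) ∷ [])
    triple len with remove U! d∈U
    ... | x ∷ y ∷ [] , _ , d∉ , split , (x≢y ∷ []) ∷ _ , ⊆U = cases (split complement-d)
      where
      middle : ∀ m → m ∈ U → d ≢ m → m ≢ d ℕ.+ a → (∀ {u} → u ∈ U → u ∈ d ∷ m ∷ (d ℕ.+ a) ∷ []) → n ≡ m ℕ.+ m
      middle m m∈ d≢m m≢d+a U⊆ with U-complement m∈
      ... | v , m+v≡n , v∈ with U⊆ v∈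
      ...   | here refl = contradiction (ℕ.+-cancelʳ-≡ d m (d ℕ.+ a) (trans m+v≡n (trans n≡ (ℕ.+-comm d (d ℕ.+ a))))) m≢d+a
      ...   | there (here refl) = sym m+v≡n
      ...   | there (there (here refl)) = contradiction (sym (ℕ.+-cancelʳ-≡ (d ℕ.+ a) m d (trans m+v≡n n≡))) d≢m
      swap : ∀ {u v w z : ℕ} → u ∈ v ∷ w ∷ z ∷ [] → u ∈ v ∷ z ∷ w ∷ []
      swap (here e)                 = here e
      swap (there (here e))         = there (there (here e))
      swap (there (there (here e))) = there (here e)
      cases : d ℕ.+ a ∈ d ∷ x ∷ y ∷ [] → ∃[ m ] n ≡ m ℕ.+ m × m ≢ d × m ≢ d ℕ.+ a × (∀ {u} → u ∈ U → u ∈ d ∷ m ∷ (d ℕ.+ a) ∷ [])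
      cases (here e) = contradiction (sym e) d≢d+a
      cases (there (here refl)) = y , middle y (⊆U (there (here refl))) d≢y (x≢y ∘ sym) (swap ∘ split) , d≢y ∘ sym , x≢y ∘ sym , λ {_} → swap ∘ split
        where
        d≢y : d ≢ y
        d≢y refl = d∉ (there (here refl))
      cases (there (there (here refl))) = x , middle x (⊆U (here refl)) d≢x x≢y split , d≢x ∘ sym , x≢y , λ {_} → split
        where
        d≢x : d ≢ x
        d≢x refl = d∉ (here refl)
    triple len | [] , len′ , _ with trans (sym len) len′
    ... | ()
    triple len | _ ∷ [] , len′ , _ with trans (sym len) len′
    ... | ()
    triple len | _ ∷ _ ∷ _ ∷ _ , len′ , _ with trans (sym len) len′
    ... | ()

  -- Comparing the enumerators of two sets of equal size

  open Counting C C-sub b b-basis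

  wt-cover : ∀ {us : List ℕ} → (∀ {u} → u ∈ U → u ∈ us) → ∀ x y → wt x ≡ wt y → ∀ a → χ (cw a) x ≡ χ (cw a) y ⊎ wt (cw a) ∈ us
  wt-cover U⊆ x y wt≡ a with wt-trichotomy (cw∈C a)
  ... | inj₁ extreme = inj₁ (χ-extreme (cw a) x y wt≡ extreme)
  ... | inj₂ u∈      = inj₂ (U⊆ u∈)

  B-const : ∀ S S′ → wt S ≡ wt S′ → wt S ℕ.≤ t → B S ≗ B S′
  B-const S S′ wt≡ S≤t j = begin
    B S j                                ≡⟨ macWilliams S j ⟩
    F S (λ u → krawtchouk u (n ∸ u) j)   ≡⟨ Pair.F-const S S′ wt≡ U! (wt-cover id S S′ wt≡)
                                              (subst (wt S ℕ.+ length U ℕ.≤_) (trans (ℕ.+-comm t (length U)) U-length) (ℕ.+-monoˡ-≤ (length U) S≤t))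
                                              (λ u → krawtchouk u (n ∸ u) j) ⟩
    F S′ (λ u → krawtchouk u (n ∸ u) j)  ≡⟨ macWilliams S′ j ⟨
    B S′ j ∎

  module Difference {r} (r≡ : r ≡ t ℕ.+ 1) (T T′ : Word n) (T≡r : wt T ≡ r) (T′≡r : wt T′ ≡ r) where

    private
      wt≡ : wt T ≡ wt T′
      wt≡ = trans T≡r (sym T′≡r)

    g : ℕ → ℚ
    g u = F T (at u) - F T′ (at u)

    open Pair T T′ wt≡

    ΔX : Seq
    ΔX j = X T j - X T′ j

    -- Proper subsets of `T` and `T′` have at most `t` points, where `B` depends on the size only;
    -- the inclusion-exclusion sums therefore differ just in their top terms.
    ΔX-F : ∀ j → ([1-z²] ^ r · ΔX) j ≡ F T (λ u → krawtchouk u (n ∸ u) j) - F T′ (λ u → krawtchouk u (n ∸ u) j)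
    ΔX-F j = begin
      ([1-z²] ^ r · ΔX) j ≡⟨ op-- (^-linear [1-z²]-linear r) (X T) (X T′) j ⟩
      ([1-z²] ^ r · X T) j - ([1-z²] ^ r · X T′) j
        ≡⟨ cong₂ _-_ (trans (cong (λ r → ([1-z²] ^ r · X T) j) (sym T≡r)) (X-alt T j))
                     (trans (cong (λ r → ([1-z²] ^ r · X T′) j) (sym T′≡r)) (X-alt T′ j)) ⟩
      alt shift T B j - alt shift T′ B j
        ≡⟨ alt-radial shift-linear T T′ wt≡ (λ S S′ S≡ S< → B-const S S′ S≡ (ℕ.≤-pred (subst (wt S ℕ.<_) (trans T≡r (trans r≡ (ℕ.+-comm t 1))) S<))) j ⟩
      B T j - B T′ j ≡⟨ cong₂ _-_ (macWilliams T j) (macWilliams T′ j) ⟩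
      F T (λ u → krawtchouk u (n ∸ u) j) - F T′ (λ u → krawtchouk u (n ∸ u) j) ∎

    module _ {a} (n≡ : n ≡ d ℕ.+ (d ℕ.+ a)) where
      open Gap n≡

      private
        n∸d : n ∸ d ≡ d ℕ.+ a
        n∸d = trans (cong (_∸ d) n≡) (ℕ.m+n∸m≡n d (d ℕ.+ a))

        n∸[d+a] : n ∸ (d ℕ.+ a) ≡ d
        n∸[d+a] = trans (cong (_∸ (d ℕ.+ a)) n≡) (ℕ.m+n∸n≡m d (d ℕ.+ a))

        wt+l<d⊥ : ∀ l → suc (suc l) ≡ length U → wt T ℕ.+ l ℕ.< d⊥
        wt+l<d⊥ l e = ℕ.≤-reflexive (begin
          suc (wt T ℕ.+ l)         ≡⟨ cong (λ w → suc (w ℕ.+ l)) (trans T≡r r≡) ⟩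
          suc (t ℕ.+ 1 ℕ.+ l)      ≡⟨ arith t l ⟩
          suc (suc l) ℕ.+ t        ≡⟨ cong (ℕ._+ t) e ⟩
          length U ℕ.+ t           ≡⟨ U-length ⟩
          d⊥ ∎)
          where
          arith : ∀ t l → suc (t ℕ.+ 1 ℕ.+ l) ≡ suc (suc l) ℕ.+ t
          arith = ℕ-Solver.solve-∀

      -- Here d⊥ - (t + 1) = 1, so the constant `poly []` is the test polynomial left; it yields
      -- `g d + g (d + a) = 0`.
      pair-ΔX : length U ≡ 2 → ∀ j → ([1-z²] ^ r · ΔX) j ≡ g d * (krawtchouk d (d ℕ.+ a) j - krawtchouk (d ℕ.+ a) d j)
      pair-ΔX len j = begin
        ([1-z²] ^ r · ΔX) j ≡⟨ ΔX-F j ⟩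
        F T φ - F T′ φ      ≡⟨ F-expand us! cover′ φ ⟩
        φ d * g d + (φ (d ℕ.+ a) * g (d ℕ.+ a) + 0ℚ)
          ≡⟨ lem (φ d) (φ (d ℕ.+ a)) (g d) (g (d ℕ.+ a))
               (trans (sym (F-expand us! cover′ (poly []))) (x≡y⇒x-y≡0 (F-poly-≡ [] (wt+l<d⊥ 0 (sym len))))) ⟩
        g d * (φ d - φ (d ℕ.+ a)) ≡⟨ cong₂ (λ p q → g d * (krawtchouk d p j - krawtchouk (d ℕ.+ a) q j)) n∸d n∸[d+a] ⟩
        g d * (krawtchouk d (d ℕ.+ a) j - krawtchouk (d ℕ.+ a) d j) ∎
        where
        φ : ℕ → ℚ
        φ u = krawtchouk u (n ∸ u) j
        us! : Unique (d ∷ (d ℕ.+ a) ∷ [])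
        us! = (d≢d+a ∷ []) ∷ [] ∷ []
        cover′ = wt-cover (pair len) T T′ wt≡
        ring : ∀ p q x y → p * x + (q * y + 0ℚ) ≡ x * (p - q) + q * (1ℚ * x + (1ℚ * y + 0ℚ))
        ring = solve-∀ ℚ-ring
        ring′ : ∀ p q → p + q * 0ℚ ≡ p
        ring′ = solve-∀ ℚ-ring
        lem : ∀ p q x y → 1ℚ * x + (1ℚ * y + 0ℚ) ≡ 0ℚ → p * x + (q * y + 0ℚ) ≡ x * (p - q)
        lem p q x y e = trans (ring p q x y) (trans (cong (λ s → x * (p - q) + q * s) e) (ring′ (x * (p - q)) q))

      -- Here d⊥ - (t + 1) = 2, so degrees 0 and 1 are available. The degree 1 condition gives
      -- `g d = g (d + a)`, and the constant then gives `g m = -2 g d`.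
      triple-ΔX : length U ≡ 3 → ∀ {m} → n ≡ m ℕ.+ m → m ≢ d → m ≢ d ℕ.+ a → (∀ {u} → u ∈ U → u ∈ d ∷ m ∷ (d ℕ.+ a) ∷ []) → ∀ j →
        ([1-z²] ^ r · ΔX) j ≡ g d * (krawtchouk d (d ℕ.+ a) j + krawtchouk (d ℕ.+ a) d j - (1ℚ + 1ℚ) * krawtchouk m m j)
      triple-ΔX len {m} n≡m+m m≢d m≢d+a U⊆ j = begin
        ([1-z²] ^ r · ΔX) j ≡⟨ ΔX-F j ⟩
        F T φ - F T′ φ      ≡⟨ F-expand us! cover′ φ ⟩
        φ d * g d + (φ m * g m + (φ (d ℕ.+ a) * g (d ℕ.+ a) + 0ℚ))
          ≡⟨ lem (φ d) (φ m) (φ (d ℕ.+ a)) (g d) (g m) (g (d ℕ.+ a)) g-equal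
               (trans (sym (F-expand us! cover′ (poly []))) (x≡y⇒x-y≡0 (F-poly-≡ []
                 (ℕ.≤-<-trans (ℕ.+-monoʳ-≤ (wt T) ℕ.z≤n) (wt+l<d⊥ 1 (sym len)))))) ⟩
        g d * (φ d + φ (d ℕ.+ a) - (1ℚ + 1ℚ) * φ m)
          ≡⟨ cong₂ (λ p q → g d * (p - (1ℚ + 1ℚ) * q))
               (cong₂ (λ p q → krawtchouk d p j + krawtchouk (d ℕ.+ a) q j) n∸d n∸[d+a])
               (cong (λ p → krawtchouk m p j) (trans (cong (_∸ m) n≡m+m) (ℕ.m+n∸m≡n m m))) ⟩
        g d * (krawtchouk d (d ℕ.+ a) j + krawtchouk (d ℕ.+ a) d j - (1ℚ + 1ℚ) * krawtchouk m m j) ∎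
        where
        φ : ℕ → ℚ
        φ u = krawtchouk u (n ∸ u) j
        us! : Unique (d ∷ m ∷ (d ℕ.+ a) ∷ [])
        us! = (m≢d ∘ sym ∷ d≢d+a ∷ []) ∷ (m≢d+a ∷ []) ∷ [] ∷ []
        cover′ = wt-cover U⊆ T T′ wt≡
        m-[d+a]≡d-m : ↑ m - ↑ (d ℕ.+ a) ≡ - (↑ m - ↑ d)
        m-[d+a]≡d-m = trans (ring₀ (↑ m) (↑ (d ℕ.+ a)) (↑ d)) (trans (cong (λ q → q - (↑ d + ↑ (d ℕ.+ a)) - (↑ m - ↑ d)) (trans (sym (↑-homo-+ m m)) (trans (cong ↑_ (trans (sym n≡m+m) n≡)) (↑-homo-+ d (d ℕ.+ a)))))
          (ring₁ (↑ d + ↑ (d ℕ.+ a)) (↑ m - ↑ d)))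
          where
          ring₀ : ∀ m e d → m - e ≡ m + m - (d + e) - (m - d)
          ring₀ = solve-∀ ℚ-ring
          ring₁ : ∀ s q → s - s - q ≡ - q
          ring₁ = solve-∀ ℚ-ring
        -- The root `m` removes `g m`; since `d` and `d + a` are equally far from `m` on opposite
        -- sides, the two remaining coefficients are opposite.
        g-equal : g d ≡ g (d ℕ.+ a)
        g-equal = x-y≡0⇒x≡y (x*y≡0⇒y≡0 (*-≢0 {1ℚ + 1ℚ} (λ ()) (λ e → m≢d (↑-injective (x-y≡0⇒x≡y e)))) (begin
          ((1ℚ + 1ℚ) * (↑ m - ↑ d)) * (g d - g (d ℕ.+ a)) ≡⟨ ring₂ (↑ m - ↑ d) (↑ m) (g d) (g m) (g (d ℕ.+ a)) ⟩
          (1ℚ + 1ℚ) * (↑ m - ↑ d) * 1ℚ * g d + ((1ℚ + 1ℚ) * (↑ m - ↑ m) * 1ℚ * g m + ((1ℚ + 1ℚ) * (- (↑ m - ↑ d)) * 1ℚ * g (d ℕ.+ a) + 0ℚ))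
            ≡⟨ cong (λ q → (1ℚ + 1ℚ) * (↑ m - ↑ d) * 1ℚ * g d + ((1ℚ + 1ℚ) * (↑ m - ↑ m) * 1ℚ * g m + ((1ℚ + 1ℚ) * q * 1ℚ * g (d ℕ.+ a) + 0ℚ))) m-[d+a]≡d-m ⟨
          ∑ᴸ (d ∷ m ∷ (d ℕ.+ a) ∷ []) (λ u → poly (m ∷ []) u * g u) ≡⟨ F-expand us! cover′ (poly (m ∷ [])) ⟨
          F T (poly (m ∷ [])) - F T′ (poly (m ∷ [])) ≡⟨ x≡y⇒x-y≡0 (F-poly-≡ (m ∷ []) (wt+l<d⊥ 1 (sym len))) ⟩
          0ℚ ∎))
          where
          ring₂ : ∀ q m x y z → ((1ℚ + 1ℚ) * q) * (x - z) ≡ (1ℚ + 1ℚ) * q * 1ℚ * x + ((1ℚ + 1ℚ) * (m - m) * 1ℚ * y + ((1ℚ + 1ℚ) * (- q) * 1ℚ * z + 0ℚ))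
          ring₂ = solve-∀ ℚ-ring
        ring : ∀ p q s x y → p * x + (q * y + (s * x + 0ℚ)) ≡ x * (p + s - (1ℚ + 1ℚ) * q) + q * (1ℚ * x + (1ℚ * y + (1ℚ * x + 0ℚ)))
        ring = solve-∀ ℚ-ring
        ring′ : ∀ p q → p + q * 0ℚ ≡ p
        ring′ = solve-∀ ℚ-ring
        lem : ∀ p q s x y z → x ≡ z → 1ℚ * x + (1ℚ * y + (1ℚ * z + 0ℚ)) ≡ 0ℚ → p * x + (q * y + (s * z + 0ℚ)) ≡ x * (p + s - (1ℚ + 1ℚ) * q)
        lem p q s x y z refl e = trans (ring p q s x y) (trans (cong (λ v → x * (p + s - (1ℚ + 1ℚ) * q) + q * v) e) (ring′ (x * (p + s - (1ℚ + 1ℚ) * q)) q))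

  -- The vanishing coefficient and the designs

  odd-design : length U ≡ 2 → ∀ {r} → r ≡ t ℕ.+ 1 → ∀ w →
    (β (↑ d - ↑ r) ⋆ odd (binom (↑ n - ↑ 2 * ↑ d))) w ≡ 0ℚ →
    IsDesign r (supportDesign (C ⊥) (2 ℕ.* w ℕ.+ 1 ℕ.+ r))
  odd-design len {r} r≡ w vanish = design r (2 ℕ.* w ℕ.+ 1) X-const
    where
    X-const : ∀ T T′ → wt T ≡ r → wt T′ ≡ r → X T (2 ℕ.* w ℕ.+ 1) ≡ X T′ (2 ℕ.* w ℕ.+ 1)
    X-const T T′ T≡ T′≡ with ∃-gap
    ... | a , n≡ = x-y≡0⇒x≡y {X T (2 ℕ.* w ℕ.+ 1)} {X T′ (2 ℕ.* w ℕ.+ 1)} (begin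
      odd ΔX w ≡⟨ odd-coefficient r d a (g d) {ΔX} (pair-ΔX n≡ len) w ⟩
      (g d * (1ℚ + 1ℚ)) * (β (↑ d - ↑ r) ⋆ odd (binom (↑ a))) w
        ≡⟨ cong (λ q → (g d * (1ℚ + 1ℚ)) * (β (↑ d - ↑ r) ⋆ odd (binom q)) w) (gap-ℚ {n} {d} {a} n≡) ⟨
      (g d * (1ℚ + 1ℚ)) * (β (↑ d - ↑ r) ⋆ odd (binom (↑ n - ↑ 2 * ↑ d))) w ≡⟨ cong ((g d * (1ℚ + 1ℚ)) *_) vanish ⟩
      (g d * (1ℚ + 1ℚ)) * 0ℚ ≡⟨ ℚ.*-zeroʳ (g d * (1ℚ + 1ℚ)) ⟩
      0ℚ ∎)
      where open Difference r≡ T T′ T≡ T′≡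

  even-design : length U ≡ 3 → ∀ {r} → r ≡ t ℕ.+ 1 → ∀ w →
    (β (↑ d - ↑ r) ⋆ even (binom (↑ n - ↑ 2 * ↑ d))) w + -1^ (w ℕ.+ 1) * binom (ℤ.+ n / 2 - ↑ r) w ≡ 0ℚ →
    IsDesign r (supportDesign (C ⊥) (2 ℕ.* w ℕ.+ r))
  even-design len {r} r≡ w vanish = design r (2 ℕ.* w) X-const
    where
    P : ℚ → ℚ
    P q = (β (↑ d - ↑ r) ⋆ even (binom q)) w
    lem : ∀ c s y → c - s * y ≡ c + (- s) * y
    lem = solve-∀ ℚ-ring
    X-const : ∀ T T′ → wt T ≡ r → wt T′ ≡ r → X T (2 ℕ.* w) ≡ X T′ (2 ℕ.* w)
    X-const T T′ T≡ T′≡ with ∃-gap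
    ... | a , n≡ with Gap.triple n≡ len
    ...   | m , n≡m+m , m≢d , m≢d+a , U⊆ = x-y≡0⇒x≡y {X T (2 ℕ.* w)} {X T′ (2 ℕ.* w)} (begin
      even ΔX w ≡⟨ even-coefficient r d a m (g d) {ΔX} (triple-ΔX n≡ len n≡m+m m≢d m≢d+a U⊆) w ⟩
      (g d * (1ℚ + 1ℚ)) * (P (↑ a) - β (↑ m - ↑ r) w)
        ≡⟨ cong₂ (λ p q → (g d * (1ℚ + 1ℚ)) * (P p - β (q - ↑ r) w)) (gap-ℚ {n} {d} {a} n≡) n/2≡m ⟨
      (g d * (1ℚ + 1ℚ)) * (P (↑ n - ↑ 2 * ↑ d) - -1^ w * binom (ℤ.+ n / 2 - ↑ r) w)
        ≡⟨ cong ((g d * (1ℚ + 1ℚ)) *_) (lem (P (↑ n - ↑ 2 * ↑ d)) (-1^ w) (binom (ℤ.+ n / 2 - ↑ r) w)) ⟩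
      (g d * (1ℚ + 1ℚ)) * (P (↑ n - ↑ 2 * ↑ d) + (- (-1^ w)) * binom (ℤ.+ n / 2 - ↑ r) w)
        ≡⟨ cong (λ q → (g d * (1ℚ + 1ℚ)) * (P (↑ n - ↑ 2 * ↑ d) + q * binom (ℤ.+ n / 2 - ↑ r) w)) (-1^+1 w) ⟨
      (g d * (1ℚ + 1ℚ)) * (P (↑ n - ↑ 2 * ↑ d) + -1^ (w ℕ.+ 1) * binom (ℤ.+ n / 2 - ↑ r) w)
        ≡⟨ cong ((g d * (1ℚ + 1ℚ)) *_) vanish ⟩
      (g d * (1ℚ + 1ℚ)) * 0ℚ ≡⟨ ℚ.*-zeroʳ (g d * (1ℚ + 1ℚ)) ⟩
      0ℚ ∎)
      where
      open Difference r≡ T T′ T≡ T′≡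
      -- The rational n/2 of the hypothesis is the middle weight of the code.
      n/2≡m : ℤ.+ n / 2 ≡ ↑ m
      n/2≡m = trans (cong (λ l → ℤ.+ l / 2) n≡m+m) (↑-/2 m)

-- Opened only here because of the sections (x +_) above.
open import Data.Integer.Base using (+_)

-- From integer differences to sums of natural numbers

u≤n-t⇒u+t≤n : ∀ u n t → + u ℤ.≤ + n ℤ.- + t → u ℕ.+ t ℕ.≤ n
u≤n-t⇒u+t≤n u n t u≤ = ℤ.drop‿+≤+ (subst (λ z → + u ℤ.+ + t ℤ.≤ z) (lem (+ n) (+ t)) (ℤ.+-monoˡ-≤ (+ t) u≤))
  where
  lem : ∀ n t → n ℤ.- t ℤ.+ t ≡ n
  lem = ℤ-Solver.solve-∀

u+t≤n⇒u≤n-t : ∀ u n t → u ℕ.+ t ℕ.≤ n → + u ℤ.≤ + n ℤ.- + t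
u+t≤n⇒u≤n-t u n t u+t≤n = subst (ℤ._≤ + n ℤ.- + t) (lem (+ u) (+ t)) (ℤ.+-monoˡ-≤ (ℤ.- + t) (ℤ.+≤+ u+t≤n))
  where
  lem : ∀ u t → u ℤ.+ t ℤ.- t ≡ u
  lem = ℤ-Solver.solve-∀

d-t≡s⇒s+t≡d : ∀ d t s → + d ℤ.- + t ≡ + s → s ℕ.+ t ≡ d
d-t≡s⇒s+t≡d d t s e = ℤ.+-injective (trans (cong (ℤ._+ + t) (sym e)) (lem (+ d) (+ t)))
  where
  lem : ∀ d t → d ℤ.- t ℤ.+ t ≡ d
  lem = ℤ-Solver.solve-∀

theorem1p2 : (n k d d⊥ t s w : ℕ) (C : Pred (Word n) 0ℓ) →
    IsLinearCode n k d C →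
    C (𝟏 n) →
    IsMinimumDistance (C ⊥) d⊥ →
    1 ℕ.≤ t →
    HasCardinality (λ u → ∃ (C at-weight u) × 0 ℕ.< u × + u ℤ.≤ + n ℤ.- + t) s →
    + d⊥ ℤ.- + t ≡ + s →
    ( d⊥ ≡ 4 × t ≡ 2 →
    ∑[ i ≤ w ] (-1^ (w ∸ toℕ i) * binom (↑ d - ↑ 3) (w ∸ toℕ i) * binom (↑ n - ↑ 2 * ↑ d) (2 ℕ.* toℕ i ℕ.+ 1)) ≡ 0ℚ →
    IsDesign 3 (supportDesign (C ⊥) (2 ℕ.* w ℕ.+ 4)) )
    ×
    ( (d⊥ ≡ 4 × t ≡ 1) ⊎ (d⊥ ≡ 6 × t ≡ 3) →
    (∑[ i ≤ w ] (-1^ (w ∸ toℕ i) * binom (↑ d - ↑ (t ℕ.+ 1)) (w ∸ toℕ i) * binom (↑ n - ↑ 2 * ↑ d) (2 ℕ.* toℕ i))) + -1^ (w ℕ.+ 1) * binom (+ n / 2 - ↑ (t ℕ.+ 1)) w ≡ 0ℚ →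
    IsDesign (t ℕ.+ 1) (supportDesign (C ⊥) (2 ℕ.* w ℕ.+ t ℕ.+ 1)) )
theorem1p2 n k d d⊥ t s w C C-linear 𝟏∈C ⊥-min 1≤t (U , U! , U⇔ , U≡s) d⊥-t≡s = part₁ , part₂
  where
  open IsLinearCode C-linear using (isSubspace; dimension; isMinimumDistance)

  s+t≡d⊥ : s ℕ.+ t ≡ d⊥
  s+t≡d⊥ = d-t≡s⇒s+t≡d d⊥ t s d⊥-t≡s

  U-sound : ∀ {u} → u ∈ U → ∃ (C at-weight u) × 0 ℕ.< u × u ℕ.+ t ℕ.≤ n
  U-sound {u} u∈ with Equivalence.to (U⇔ u) u∈
  ... | c , 0<u , u≤n-t = c , 0<u , u≤n-t⇒u+t≤n u n t u≤n-t

  U-complete : ∀ {c} → C c → 0 ℕ.< wt c → wt c ℕ.+ t ℕ.≤ n → wt c ∈ U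
  U-complete {c} c∈ 0<wt wt+t≤n = Equivalence.from (U⇔ (wt c)) ((c , c∈ , refl) , 0<wt , u+t≤n⇒u≤n-t (wt c) n t wt+t≤n)

  U-length : length U ℕ.+ t ≡ d⊥
  U-length = trans (cong (ℕ._+ t) U≡s) s+t≡d⊥

  module W = Weights C isSubspace (proj₁ dimension) (proj₂ dimension) 𝟏∈C isMinimumDistance ⊥-min
    U U! U-sound U-complete U-length 1≤t

  part₁ : d⊥ ≡ 4 × t ≡ 2 →
    (β (↑ d - ↑ 3) ⋆ odd (binom (↑ n - ↑ 2 * ↑ d))) w ≡ 0ℚ →
    IsDesign 3 (supportDesign (C ⊥) (2 ℕ.* w ℕ.+ 4))
  -- A block has 2w + 1 points outside the given triple, so its size is (2w + 1) + 3.
  part₁ (refl , refl) vanish = subst (IsDesign 3 ∘ supportDesign (C ⊥)) (ℕ.+-assoc (2 ℕ.* w) 1 3)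
    (W.odd-design ℕ.≤-refl (ℕ.≤-reflexive (sym U≡2)) U≡2 refl w vanish)
    where
    U≡2 : length U ≡ 2
    U≡2 = trans U≡s (ℕ.+-cancelʳ-≡ 2 s 2 s+t≡d⊥)

  part₂ : (d⊥ ≡ 4 × t ≡ 1) ⊎ (d⊥ ≡ 6 × t ≡ 3) →
    (β (↑ d - ↑ (t ℕ.+ 1)) ⋆ even (binom (↑ n - ↑ 2 * ↑ d))) w + -1^ (w ℕ.+ 1) * binom (+ n / 2 - ↑ (t ℕ.+ 1)) w ≡ 0ℚ →
    IsDesign (t ℕ.+ 1) (supportDesign (C ⊥) (2 ℕ.* w ℕ.+ t ℕ.+ 1))
  part₂ params vanish = subst (IsDesign (t ℕ.+ 1) ∘ supportDesign (C ⊥)) (sym (ℕ.+-assoc (2 ℕ.* w) t 1))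
    (W.even-design (t+t≤d⊥ params) (subst (2 ℕ.≤_) (sym U≡3) (ℕ.s≤s (ℕ.s≤s ℕ.z≤n))) U≡3 refl w vanish)
    where
    s≡3 : (d⊥ ≡ 4 × t ≡ 1) ⊎ (d⊥ ≡ 6 × t ≡ 3) → s ≡ 3
    s≡3 (inj₁ (refl , refl)) = ℕ.+-cancelʳ-≡ 1 s 3 s+t≡d⊥
    s≡3 (inj₂ (refl , refl)) = ℕ.+-cancelʳ-≡ 3 s 3 s+t≡d⊥
    U≡3 : length U ≡ 3
    U≡3 = trans U≡s (s≡3 params)
    -- This inequality feeds the exclusion of `d < t`; for (6, 3) it is an equality.
    t+t≤d⊥ : (d⊥ ≡ 4 × t ≡ 1) ⊎ (d⊥ ≡ 6 × t ≡ 3) → t ℕ.+ t ℕ.≤ d⊥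
    t+t≤d⊥ (inj₁ (refl , refl)) = ℕ.s≤s (ℕ.s≤s ℕ.z≤n)
    t+t≤d⊥ (inj₂ (refl , refl)) = ℕ.≤-refl
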